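{- Let $q$ be a prime power. For all integers $h,s\ge 2$ we have $n_q(hs+\lfloor 0.5h\rfloor,h;s)\ge q^h+2$.
   Context: All dimensions are vector-space dimensions; a hyperplane of $\mathbb{F}_q^r$ is an $(r-1)$-dimensional subspace. A projective $h-(n,r,s)_q$ system is a multiset of $n$ subspaces of $\mathbb{F}_q^r$, each of dimension at most $h$, such that each hyperplane contains at most $s$ of these subspaces (counted with multiplicity) and some hyperplane contains exactly $s$ of them. $n_q(r,h;s)$ denotes the maximum $n$ such that a projective $h-(n,r,s)_q$ system exists. -}

module Defs where

open import Level using (Level; _⊔_) renaming (suc to lsuc)
open import Algebra.Bundles using (CommutativeRing)
open import Algebra.Apartness.Bundles using (HeytingField; HeytingCommutativeRing)
open import Data.Fin.Base using (Fin)
open import Data.Fin.Subset using (Subset; _∈_; ∣_∣)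
open import Data.Nat.Base using (ℕ; suc; _≤_; _^_)
open import Data.Nat.Primality using (Prime)
open import Data.Product.Base using (Σ-syntax; ∃-syntax; _×_)
open import Data.Vec.Functional using (Vector; map; zipWith; replicate)
open import Function.Bundles using (Inverse; _⇔_)
open import Relation.Binary.PropositionalEquality using (_≡_)
import Relation.Binary.PropositionalEquality as ≡
open import Relation.Unary using (Pred; _⊆_)
import Algebra.Properties.Monoid.Sum as Sum
import Data.Vec.Functional.Relation.Binary.Equality.Setoid as VecEquality

IsPrimePower : ℕ → Set
IsPrimePower q = ∃[ p ] ∃[ k ] (Prime p × 1 ≤ k × q ≡ p ^ k)

-- The predicate P on Fin n holds at exactly k indices.
HoldsExactly : ∀ {a n} → Pred (Fin n) a → ℕ → Set a
HoldsExactly {n = n} P k =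
  Σ[ T ∈ Subset n ] ((∀ i → i ∈ T ⇔ P i) × ∣ T ∣ ≡ k)

record IsMaximum {a} (P : Pred ℕ a) (n : ℕ) : Set a where
  field
    attained   : P n
    upperBound : ∀ m → P m → m ≤ n

-- A finite Heyting field has decidable equality, and its apartness is then
-- the negation of equality, so with HasOrder below this is a finite field in
-- the usual sense.
module _ {c ℓ₁ ℓ₂} (F : HeytingField c ℓ₁ ℓ₂) where

  open HeytingField F
    using (Carrier; _≈_; _*_; _+_; 0#; heytingCommutativeRing)
  open HeytingCommutativeRing heytingCommutativeRing using (commutativeRing)
  open CommutativeRing commutativeRing using (setoid; +-monoid)
  open VecEquality setoid using (_≋_)
  open Sum +-monoid using (sum)

  HasOrder : ℕ → Set (c ⊔ ℓ₁)
  HasOrder q = Inverse setoid (≡.setoid (Fin q))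

  linearCombination : ∀ {k r} → Vector Carrier k → Vector (Vector Carrier r) k →
                      Vector Carrier r
  linearCombination a b j = sum (λ i → a i * b i j)

  -- Predicates live at level c ⊔ ℓ₁ because that is the level of the span of
  -- a family of vectors.
  record Subspace (r : ℕ) : Set (lsuc (c ⊔ ℓ₁)) where
    field
      Member   : Pred (Vector Carrier r) (c ⊔ ℓ₁)
      resp     : ∀ {v w} → v ≋ w → Member v → Member w
      0-mem    : Member (replicate r 0#)
      +-closed : ∀ {v w} → Member v → Member w → Member (zipWith _+_ v w)
      *-closed : ∀ a {v} → Member v → Member (map (a *_) v)

  open Subspace public using (Member)

  record IsBasis {r k} (U : Subspace r) (b : Vector (Vector Carrier r) k) :
         Set (c ⊔ ℓ₁) where
    field
      members     : ∀ i → Member U (b i)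
      independent : ∀ a → linearCombination a b ≋ replicate r 0# →
                    ∀ i → a i ≈ 0#
      spanning    : ∀ {v} → Member U v → ∃[ a ] (linearCombination a b ≋ v)

  HasDimension : ∀ {r} → Subspace r → ℕ → Set (c ⊔ ℓ₁)
  HasDimension {r} U k = Σ[ b ∈ Vector (Vector Carrier r) k ] IsBasis U b

  IsHyperplane : ∀ {r} → Subspace r → Set (c ⊔ ℓ₁)
  IsHyperplane {r} H = ∃[ k ] (HasDimension H k × suc k ≡ r)

  ContainsExactly : ∀ {n r} → Subspace r → Vector (Subspace r) n → ℕ →
                    Set (c ⊔ ℓ₁)
  ContainsExactly H U = HoldsExactly (λ i → Member (U i) ⊆ Member H)

  -- A multiset of n subspaces is given as a family indexed by Fin n.
  record ProjectiveSystem (h n r s : ℕ) : Set (lsuc (c ⊔ ℓ₁)) where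
    field
      spaces    : Vector (Subspace r) n
      dimension : ∀ i → ∃[ k ] (HasDimension (spaces i) k × k ≤ h)
      atMost    : ∀ H → IsHyperplane H →
                  ∃[ k ] (ContainsExactly H spaces k × k ≤ s)
      exactly   : ∃[ H ] (IsHyperplane H × ContainsExactly H spaces s)

  -- "n_q(r,h;s) = n", as a relation, since the maximum of a set of naturals
  -- is not a total operation.
  IsMaxSize : (r h s n : ℕ) → Set (lsuc (c ⊔ ℓ₁))
  IsMaxSize r h s = IsMaximum (λ n → ProjectiveSystem h n r s)

{-# OPTIONS --safe #-}
-- Dually, a system of n spaces of dimension ≤ h in F_q^r is a code: φ ∈ F_q^r gives the word whose i-th
-- entry is the restriction of the functional φ to the i-th space, and the hyperplane φ ⊥ contains exactly
-- the spaces where this word vanishes.  So at most s zeros are allowed in each word with φ ≠ 0.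
--
-- For r = h s + k, k = ⌊h/2⌋, let φ be the polynomial f = a₀ + … + a_s x^s over K = F_{q^h} with a_s in a
-- k-dimensional F_q-subspace.  Take the q^h entries f (x), x ∈ K, and two more entries in F_q^h which both
-- contain the k coordinates of a_s and share out the h coordinates of a_{s-1}; there is room as 2k ≤ h.
-- If a_s ≠ 0 there are at most s roots and the extra entries are nonzero.  If a_s = 0 ≠ a_{s-1}, there are
-- at most s - 1 roots and one of the extra entries is nonzero.  Otherwise there are at most s - 2 roots.
--
-- K is a quotient of R = F_q[X] / (X^N - X), N = q^h, in which every element satisfies y^N = y.  The product
-- u of the X^{q^d} - X with 1 ≤ d < h has degree < N, so u ≠ 0 and some field quotient K of R has u ≠ 0.
-- If K has dimension d over F_q, then X^{q^d} = X in K gives d ≥ h, and y^N = y on K gives d ≤ h.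
--
-- The maximum exists because the existence of a code of given length is decidable and the length is bounded;
-- at the maximum some hyperplane contains exactly s spaces, as otherwise the zero space could be added.
module Submission where

open import Defs
open import Algebra.Apartness.Bundles using (HeytingField; HeytingCommutativeRing)
open import Algebra.Bundles using (CommutativeRing; Semiring)
open import Algebra.Module.Bundles using (LeftSemimodule)
open import Algebra.Morphism.Structures using (module SemiringMorphisms)
import Algebra.Properties.AbelianGroup
import Algebra.Properties.CommutativeMonoid.Sum
import Algebra.Properties.CommutativeSemigroup
import Algebra.Properties.CommutativeSemiring.Binomial
import Algebra.Properties.CommutativeSemiring.Exp
import Algebra.Properties.Group
import Algebra.Properties.Ring
import Algebra.Properties.Semiring.Exp
import Algebra.Properties.Semiring.Mult
import Algebra.Properties.Semiring.Sum
import Algebra.Solver.Ring.NaturalCoefficients.Default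
open import Data.Fin.Base using (Fin; zero; suc; toℕ; fromℕ; fromℕ<; inject₁; punchIn; punchOut;
  _↑ˡ_; _↑ʳ_; splitAt; combine; funToFin; finToFun)
import Data.Fin.Properties as Fin
open import Data.Fin.Subset using (Subset; _∈_; ∣_∣; inside; outside; ⊤; ⊥; _∪_)
import Data.Fin.Subset.Properties as Subset
open import Data.List.Base as List using (List; []; _∷_; length; _++_)
import Data.List.Properties as List
open import Data.List.Relation.Unary.All using (All; []; _∷_)
import Data.List.Relation.Unary.All.Properties as All
open import Data.Maybe.Base using (Maybe; just; nothing; maybe′)
open import Data.Nat.Base as ℕ using (ℕ; zero; suc; z≤n; s≤s)
open import Data.Nat.Combinatorics using (_C_; nCn≡1; k![n∸k]!∣n!)
open import Data.Nat.Combinatorics.Specification using (nCk≡n!/k![n-k]!)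
open import Data.Nat.Divisibility using (_∣_; divides; _∤_; m∣m*n; ∣⇒≤)
open import Data.Nat.DivMod using (_%_; _mod_; m/n*n≡m; m%n<n; m%n%n≡m%n;
  %-distribˡ-+; [m+n]%n≡m%n; m<n⇒m%n≡m)
open import Data.Nat.GeneralisedArithmetic using (iterate)
open import Data.Nat.Primality using (Prime; euclidsLemma; prime⇒nonZero; prime⇒nonTrivial)
import Data.Nat.Properties as ℕ
open import Data.Product.Base using (Σ-syntax; ∃; ∃-syntax; _×_; _,_; proj₁; proj₂)
open import Data.Sum.Base using (_⊎_; inj₁; inj₂; [_,_]′)
open import Data.Vec.Base as Vec using ([]; _∷_)
open import Data.Vec.Functional as Vector using (Vector)
import Data.Vec.Functional.Relation.Binary.Equality.Setoid as VecEquality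
import Data.Vec.Properties as Vec
open import Function.Base using (_∘_)
open import Function.Bundles using (Inverse; _↔_; mk↔ₛ′; mk⇔; Equivalence)
open import Level using (Level; _⊔_; Lift; lift; lower)
open import Relation.Binary.Bundles using (Setoid)
open import Relation.Binary.Definitions using (_Respects_) renaming (Decidable to Decidable₂)
open import Relation.Binary.PropositionalEquality as ≡ using (_≡_; _≢_)
import Relation.Binary.Reasoning.Setoid as SetoidReasoning
open import Relation.Nullary.Decidable using (Dec; yes; no; does; map′; dec-true; decidable-stable;
  ¬?; _×-dec_; _→-dec_)
open import Relation.Nullary.Negation using (¬_; contradiction)
open import Relation.Unary using (Pred; Decidable) renaming (_⊆_ to _⊆′_)

private variable
  c c′ ℓ ℓ′ ℓ₁ ℓ₂ ℓ₃ ℓm m m₁ m₂ m₃ p : Level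
  n : ℕ

-- Finite search and counting

module _ {S : Setoid c ℓ} (enum : Inverse S (≡.setoid (Fin n))) where

  open Setoid S
  open Inverse enum

  finite-≟ : ∀ x y → Dec (x ≈ y)
  finite-≟ x y = map′ injective to-cong (to x Fin.≟ to y)
    where
    injective : to x ≡ to y → x ≈ y
    injective eq = trans (sym (strictlyInverseʳ x)) (trans (from-cong eq) (strictlyInverseʳ y))

  finite-any? : {P : Pred Carrier p} → P Respects _≈_ → Decidable P → Dec (∃ P)
  finite-any? resp P? = map′
    (λ (i , Pi) → from i , Pi)
    (λ (x , Px) → to x , resp (sym (strictlyInverseʳ x)) Px)
    (Fin.any? (P? ∘ from))

  finite-all? : {P : Pred Carrier p} → P Respects _≈_ → Decidable P → Dec (∀ x → P x)
  finite-all? resp P? = map′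
    (λ all x → resp (strictlyInverseʳ x) (all (to x)))
    (λ all i → all (from i))
    (Fin.all? (P? ∘ from))

  -- Being iterable, this makes whole families of vectors searchable; `hasCode?` nests it three
  -- times.
  vectorEnum : ∀ r → Inverse (VecEquality.≋-setoid S r) (≡.setoid (Fin (n ℕ.^ r)))
  vectorEnum r = record
    { to        = λ v → funToFin (to ∘ v)
    ; from      = λ i → from ∘ finToFun i
    ; to-cong   = λ v≋w → funToFin-cong (λ j → to-cong (v≋w j))
    ; from-cong = λ { ≡.refl j → refl }
    ; inverse   =
        (λ {i} {v} v≋i → ≡.trans
          (funToFin-cong (λ j → ≡.trans (to-cong (v≋i j)) (strictlyInverseˡ _)))
          (Fin.funToFin-finToFin {r} {n} i)) ,
        (λ { {v} ≡.refl j → trans (from-cong (Fin.finToFun-funToFin (to ∘ v) j)) (strictlyInverseʳ (v j)) })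
    }
    where
    funToFin-cong : ∀ {r} {f g : Fin r → Fin n} → (∀ i → f i ≡ g i) → funToFin f ≡ funToFin g
    funToFin-cong {zero}  f≗g = ≡.refl
    funToFin-cong {suc r} f≗g =
      ≡.cong₂ combine (f≗g zero) (funToFin-cong (f≗g ∘ suc))

module _ {P : Pred (Fin n) p} (P? : Decidable P) where

  satisfying : Subset n
  satisfying = Vec.tabulate (does ∘ P?)

  ∈-satisfying⁺ : ∀ {i} → P i → i ∈ satisfying
  ∈-satisfying⁺ {i} Pi = Vec.lookup⇒[]= i satisfying
    (≡.trans (Vec.lookup∘tabulate (does ∘ P?) i) (dec-true (P? i) Pi))

  ∈-satisfying⁻ : ∀ {i} → i ∈ satisfying → P i
  ∈-satisfying⁻ {i} i∈ with P? i | ≡.trans (≡.sym (Vec.lookup∘tabulate (does ∘ P?) i)) (Vec.[]=⇒lookup i∈)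
  ... | yes Pi | _  = Pi
  ... | no  _  | ()

  count : ℕ
  count = ∣ satisfying ∣

count-yes : {P : Pred (Fin (suc n)) p} (P? : Decidable P) → P zero → count P? ≡ suc (count (P? ∘ suc))
count-yes P? P0 with P? zero
... | yes _  = ≡.refl
... | no ¬P0 = contradiction P0 ¬P0

count-no : {P : Pred (Fin (suc n)) p} (P? : Decidable P) → ¬ P zero → count P? ≡ count (P? ∘ suc)
count-no P? ¬P0 with P? zero
... | yes P0 = contradiction P0 ¬P0
... | no _   = ≡.refl

count-≤ : {P : Pred (Fin (suc n)) p} (P? : Decidable P) → count P? ℕ.≤ suc (count (P? ∘ suc))
count-≤ P? with P? zero
... | yes _ = ℕ.≤-refl
... | no _  = ℕ.n≤1+n _

count-mono : ∀ {p′} {P : Pred (Fin n) p} {Q : Pred (Fin n) p′} (P? : Decidable P) (Q? : Decidable Q) →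
             (∀ i → P i → Q i) → count P? ℕ.≤ count Q?
count-mono P? Q? P⊆Q =
  Subset.p⊆q⇒∣p∣≤∣q∣ (λ i∈ → ∈-satisfying⁺ Q? (P⊆Q _ (∈-satisfying⁻ P? i∈)))

-- An injective listing is the form in which a set of roots is handed to `manyRoots⇒isZero`.
members : (T : Subset n) → ∃[ f ] ((∀ i → f i ∈ T) × (∀ {i j : Fin ∣ T ∣} → f i ≡ f j → i ≡ j))
members []            = (λ ()) , (λ ()) , (λ { {()} })
members (outside ∷ T) with f , f∈T , f-inj ← members T =
  suc ∘ f , Vec.there ∘ f∈T , f-inj ∘ Fin.suc-injective
members (inside ∷ T)  with f , f∈T , f-inj ← members T = g , g∈T , λ {i} {j} → g-inj i j
  where
  g : Fin _ → Fin _
  g zero    = zero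
  g (suc i) = suc (f i)
  g∈T : ∀ i → g i ∈ (inside ∷ T)
  g∈T zero    = Vec.here
  g∈T (suc i) = Vec.there (f∈T i)
  g-inj : ∀ i j → g i ≡ g j → i ≡ j
  g-inj zero    zero    _  = ≡.refl
  g-inj zero    (suc _) ()
  g-inj (suc _) zero    ()
  g-inj (suc i) (suc j) eq = ≡.cong suc (f-inj (Fin.suc-injective eq))

∣p∪q∣≤∣p∣+∣q∣ : (p q : Subset n) → ∣ p ∪ q ∣ ℕ.≤ ∣ p ∣ ℕ.+ ∣ q ∣
∣p∪q∣≤∣p∣+∣q∣ []            []            = z≤n
∣p∪q∣≤∣p∣+∣q∣ (outside ∷ p) (outside ∷ q) = ∣p∪q∣≤∣p∣+∣q∣ p q
∣p∪q∣≤∣p∣+∣q∣ (outside ∷ p) (inside ∷ q)  =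
  ℕ.≤-trans (s≤s (∣p∪q∣≤∣p∣+∣q∣ p q)) (ℕ.≤-reflexive (≡.sym (ℕ.+-suc ∣ p ∣ ∣ q ∣)))
∣p∪q∣≤∣p∣+∣q∣ (inside ∷ p)  (outside ∷ q) = s≤s (∣p∪q∣≤∣p∣+∣q∣ p q)
∣p∪q∣≤∣p∣+∣q∣ (inside ∷ p)  (inside ∷ q)  =
  s≤s (ℕ.≤-trans (∣p∪q∣≤∣p∣+∣q∣ p q) (ℕ.+-monoʳ-≤ ∣ p ∣ (ℕ.n≤1+n ∣ q ∣)))

-- Union bound: the union of the `T j` is everything, and its size is at most the sum of their
-- sizes.
cover-bound : ∀ {m} k s (T : Fin k → Subset m) → (∀ j → ∣ T j ∣ ℕ.≤ s) →
              (∀ i → ∃[ j ] i ∈ T j) → m ℕ.≤ k ℕ.* s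
cover-bound {m} k s T ∣T∣≤s covers =
  ℕ.≤-trans (ℕ.≤-reflexive (≡.sym (Subset.∣⊤∣≡n m)))
    (ℕ.≤-trans (Subset.p⊆q⇒∣p∣≤∣q∣ {p = ⊤} (λ {i} _ → let j , i∈Tj = covers i in ∈-union k T j i∈Tj))
      (∣union∣≤ k T ∣T∣≤s))
  where
  union : ∀ k → (Fin k → Subset m) → Subset m
  union zero    T = ⊥
  union (suc k) T = T zero ∪ union k (T ∘ suc)

  ∈-union : ∀ k T j {i} → i ∈ T j → i ∈ union k T
  ∈-union (suc k) T zero    i∈ = Subset.x∈p∪q⁺ (inj₁ i∈)
  ∈-union (suc k) T (suc j) i∈ = Subset.x∈p∪q⁺ {p = T zero} (inj₂ (∈-union k (T ∘ suc) j i∈))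

  ∣union∣≤ : ∀ k T → (∀ j → ∣ T j ∣ ℕ.≤ s) → ∣ union k T ∣ ℕ.≤ k ℕ.* s
  ∣union∣≤ zero    T _ = ℕ.≤-reflexive (Subset.∣⊥∣≡0 m)
  ∣union∣≤ (suc k) T h = ℕ.≤-trans (∣p∪q∣≤∣p∣+∣q∣ (T zero) _)
    (ℕ.+-mono-≤ (h zero) (∣union∣≤ k (T ∘ suc) (h ∘ suc)))

-- Search downwards from the upper bound; `d` is the remaining gap, and at gap zero `k` itself is
-- the maximum.
bounded-maximum : {P : Pred ℕ p} → Decidable P → ∀ k d → P k → (∀ m → P m → m ℕ.≤ d ℕ.+ k) →
                  ∃[ n ] (P n × k ℕ.≤ n × (∀ m → P m → m ℕ.≤ n))
bounded-maximum P? k zero    Pk bound = k , Pk , ℕ.≤-refl , bound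
bounded-maximum P? k (suc d) Pk bound with P? (suc d ℕ.+ k)
... | yes P[d+k] = _ , P[d+k] , ℕ.m≤n+m k (suc d) , bound
... | no ¬P[d+k] = bounded-maximum P? k d Pk
  (λ m Pm → ℕ.≤-pred (ℕ.≤∧≢⇒< (bound m Pm) λ { ≡.refl → ¬P[d+k] Pm }))

-- Linear algebra over finite fields

-- Each element comes with a decision between zero and an inverse, so that quotient rings can be
-- shown to be fields directly, with no apartness relation.
record IsFiniteField (R : CommutativeRing c ℓ) (q : ℕ) : Set (c ⊔ ℓ) where
  open CommutativeRing R hiding (zero)
  field
    enumeration : Inverse setoid (≡.setoid (Fin q))
    1≉0         : ¬ 1# ≈ 0#
    zeroOrUnit  : ∀ x → x ≈ 0# ⊎ ∃[ y ] x * y ≈ 1#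

  _≟_ : Decidable₂ _≈_
  _≟_ = finite-≟ enumeration

  order>1 : 1 ℕ.< q
  order>1 = ℕ.≰⇒> λ q≤1 → 1≉0 (trans (sym (strictlyInverseʳ 1#))
    (trans (from-cong (unique q≤1 (to 1#) (to 0#))) (strictlyInverseʳ 0#)))
    where
    open Inverse enumeration
    unique : ∀ {q} → q ℕ.≤ 1 → (i j : Fin q) → i ≡ j
    unique (s≤s z≤n) zero zero = ≡.refl

-- A semimodule as ambient space lets one development serve both coordinate vectors and an extension
-- ring viewed as a vector space; negatives come from the scalars.
module LinearCombination (R : CommutativeRing c ℓ)
         (M : LeftSemimodule (CommutativeRing.semiring R) m ℓm) where

  open CommutativeRing R hiding (zero)
  open LeftSemimodule M
  open Algebra.Properties.CommutativeMonoid.Sum +ᴹ-commutativeMonoid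
    using (sum; sum-cong-≋; sum-replicate-zero; ∑-distrib-+)
  open SetoidReasoning ≈ᴹ-setoid

  lc : Vector Carrier n → Vector Carrierᴹ n → Carrierᴹ
  lc a v = sum (λ i → a i *ₗ v i)

  lc-cong : ∀ {a a′ : Vector Carrier n} {v v′} → (∀ i → a i ≈ a′ i) → (∀ i → v i ≈ᴹ v′ i) →
            lc a v ≈ᴹ lc a′ v′
  lc-cong a≋a′ v≋v′ = sum-cong-≋ (λ i → *ₗ-cong (a≋a′ i) (v≋v′ i))

  lc-congˡ : ∀ {a a′ : Vector Carrier n} v → (∀ i → a i ≈ a′ i) → lc a v ≈ᴹ lc a′ v
  lc-congˡ v a≋a′ = lc-cong a≋a′ (λ _ → ≈ᴹ-refl)

  lc-zero : ∀ {a : Vector Carrier n} v → (∀ i → a i ≈ 0#) → lc a v ≈ᴹ 0ᴹ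
  lc-zero {n} v a≋0 = ≈ᴹ-trans
    (sum-cong-≋ (λ i → ≈ᴹ-trans (*ₗ-congʳ (a≋0 i)) (*ₗ-zeroˡ (v i))))
    (sum-replicate-zero n)

  lc-+ : ∀ (a a′ : Vector Carrier n) v → lc (λ i → a i + a′ i) v ≈ᴹ lc a v +ᴹ lc a′ v
  lc-+ a a′ v = ≈ᴹ-trans
    (sum-cong-≋ (λ i → *ₗ-distribʳ (v i) (a i) (a′ i)))
    (∑-distrib-+ (λ i → a i *ₗ v i) (λ i → a′ i *ₗ v i))

  lc-* : ∀ x (a : Vector Carrier n) v → lc (λ i → x * a i) v ≈ᴹ x *ₗ lc a v
  lc-* {zero}  x a v = ≈ᴹ-sym (*ₗ-zeroʳ x)
  lc-* {suc n} x a v = begin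
    (x * a zero) *ₗ v zero +ᴹ lc (λ i → x * a (suc i)) (v ∘ suc)
      ≈⟨ +ᴹ-cong (*ₗ-assoc x (a zero) (v zero)) (lc-* x (a ∘ suc) (v ∘ suc)) ⟩
    x *ₗ a zero *ₗ v zero +ᴹ x *ₗ lc (a ∘ suc) (v ∘ suc)
      ≈⟨ *ₗ-distribˡ x _ _ ⟨
    x *ₗ lc a v ∎

  lc-closed : (P : Pred Carrierᴹ p) → P 0ᴹ → (∀ {y z} → P y → P z → P (y +ᴹ z)) →
              (∀ x {y} → P y → P (x *ₗ y)) →
              ∀ (a : Vector Carrier n) v → (∀ i → P (v i)) → P (lc a v)
  lc-closed {n = zero}  P P0 P+ P* a v Pv = P0
  lc-closed {n = suc n} P P0 P+ P* a v Pv =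
    P+ (P* (a zero) (Pv zero)) (lc-closed P P0 P+ P* (a ∘ suc) (v ∘ suc) (Pv ∘ suc))

  Independent : Vector Carrierᴹ n → Set _
  Independent v = ∀ a → lc a v ≈ᴹ 0ᴹ → ∀ i → a i ≈ 0#

  Span : Vector Carrierᴹ n → Pred Carrierᴹ _
  Span v y = ∃[ a ] lc a v ≈ᴹ y

  module _ {v : Vector Carrierᴹ n} where

    span-resp : Span v Respects _≈ᴹ_
    span-resp y≈z (a , eq) = a , ≈ᴹ-trans eq y≈z

    span-0 : Span v 0ᴹ
    span-0 = (λ _ → 0#) , lc-zero v (λ _ → refl)

    span-+ : ∀ {y z} → Span v y → Span v z → Span v (y +ᴹ z)
    span-+ (a , eq) (a′ , eq′) = (λ i → a i + a′ i) , ≈ᴹ-trans (lc-+ a a′ v) (+ᴹ-cong eq eq′)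

    span-* : ∀ x {y} → Span v y → Span v (x *ₗ y)
    span-* x (a , eq) = (λ i → x * a i) , ≈ᴹ-trans (lc-* x a v) (*ₗ-congˡ eq)

    span-lc : ∀ {k} a (w : Vector Carrierᴹ k) → (∀ i → Span v (w i)) → Span v (lc a w)
    span-lc = lc-closed (Span v) span-0 span-+ span-*

    span-trans : ∀ {k} {w : Vector Carrierᴹ k} → (∀ i → Span v (w i)) →
                 ∀ {y} → Span w y → Span v y
    span-trans {w = w} w⊆v (a , eq) = span-resp eq (span-lc a w w⊆v)

  span-tail : ∀ (v : Vector Carrierᴹ (suc n)) {y} → Span (v ∘ suc) y → Span v y
  span-tail v (a , eq) = (0# Vector.∷ a) ,
    ≈ᴹ-trans (+ᴹ-congʳ (*ₗ-zeroˡ (v zero))) (≈ᴹ-trans (+ᴹ-identityˡ _) eq)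

  span-head : ∀ (v : Vector Carrierᴹ (suc n)) → Span v (v zero)
  span-head v = (1# Vector.∷ λ _ → 0#) ,
    ≈ᴹ-trans (+ᴹ-cong (*ₗ-identityˡ (v zero)) (lc-zero (v ∘ suc) (λ _ → refl))) (+ᴹ-identityʳ _)

  span-member : ∀ (v : Vector Carrierᴹ n) i → Span v (v i)
  span-member v zero    = span-head v
  span-member v (suc i) = span-tail v (span-member (v ∘ suc) i)

  module _ {q} (isField : IsFiniteField R q) (_≟ᴹ_ : Decidable₂ _≈ᴹ_) where
    open IsFiniteField isField

    span? : (v : Vector Carrierᴹ n) → Decidable (Span v)
    span? {n} v y = finite-any? (vectorEnum enumeration n)
      (λ a≋a′ eq → ≈ᴹ-trans (lc-congˡ v (λ i → sym (a≋a′ i))) eq)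
      (λ a → lc a v ≟ᴹ y)

    -- The list repeats elements when `v` is dependent. It supplies the elements that
    -- `fieldQuotient` runs through.
    enumerateSpan : (v : Vector Carrierᴹ n) →
                    Σ[ ys ∈ Vector Carrierᴹ (q ℕ.^ n) ] (∀ {y} → Span v y → ∃[ i ] ys i ≈ᴹ y)
    enumerateSpan {n} v = (λ i → lc (from i) v) ,
      λ (a , eq) → to a , ≈ᴹ-trans (lc-congˡ v (strictlyInverseʳ a)) eq
      where open Inverse (vectorEnum enumeration n)

    -- In a dependency, a nonzero coefficient of `y` is a unit, and dividing by it would put `y`
    -- into the span of `b`.
    independent-extend : ∀ {y} {b : Vector Carrierᴹ n} → Independent b → ¬ Span b y →
                         Independent (y Vector.∷ b)
    independent-extend {y = y} {b} ind y∉b a eq with zeroOrUnit (a zero)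
    ... | inj₁ a₀≈0 = λ where
      zero    → a₀≈0
      (suc i) → ind (a ∘ suc)
        (≈ᴹ-trans (≈ᴹ-sym (≈ᴹ-trans (+ᴹ-congʳ (≈ᴹ-trans (*ₗ-congʳ a₀≈0) (*ₗ-zeroˡ y))) (+ᴹ-identityˡ _))) eq) i
    ... | inj₂ (z , a₀z≈1) = contradiction ((λ i → - z * a (suc i)) , y≈) y∉b
      where
      L = lc (a ∘ suc) b
      y≈ : lc (λ i → - z * a (suc i)) b ≈ᴹ y
      y≈ = begin
        lc (λ i → - z * a (suc i)) b     ≈⟨ lc-* (- z) (a ∘ suc) b ⟩
        - z *ₗ L                         ≈⟨ +ᴹ-identityˡ _ ⟨
        0ᴹ +ᴹ - z *ₗ L                   ≈⟨ +ᴹ-congʳ (*ₗ-zeroʳ z) ⟨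
        z *ₗ 0ᴹ +ᴹ - z *ₗ L              ≈⟨ +ᴹ-congʳ (*ₗ-congˡ eq) ⟨
        z *ₗ (a zero *ₗ y +ᴹ L) +ᴹ - z *ₗ L
          ≈⟨ +ᴹ-congʳ (*ₗ-distribˡ z _ _) ⟩
        (z *ₗ a zero *ₗ y +ᴹ z *ₗ L) +ᴹ - z *ₗ L
          ≈⟨ +ᴹ-assoc _ _ _ ⟩
        z *ₗ a zero *ₗ y +ᴹ (z *ₗ L +ᴹ - z *ₗ L)
          ≈⟨ +ᴹ-cong (≈ᴹ-sym (*ₗ-assoc z (a zero) y)) (≈ᴹ-sym (*ₗ-distribʳ L z (- z))) ⟩
        (z * a zero) *ₗ y +ᴹ (z + - z) *ₗ L
          ≈⟨ +ᴹ-cong (*ₗ-congʳ (trans (*-comm z (a zero)) a₀z≈1)) (*ₗ-congʳ (-‿inverseʳ z)) ⟩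
        1# *ₗ y +ᴹ 0# *ₗ L
          ≈⟨ +ᴹ-cong (*ₗ-identityˡ y) (*ₗ-zeroˡ L) ⟩
        y +ᴹ 0ᴹ
          ≈⟨ +ᴹ-identityʳ y ⟩
        y ∎

    -- Greedy selection from the back: `v zero` is kept exactly when it lies outside the span of
    -- what was kept before, which finite search decides.
    extractBasis : (v : Vector Carrierᴹ n) →
                   ∃[ d ] (d ℕ.≤ n × Σ[ b ∈ Vector Carrierᴹ d ]
                     (Independent b × (∀ i → Span b (v i)) × (∀ i → Span v (b i))))
    extractBasis {zero}  v = 0 , z≤n , (λ ()) , (λ _ _ ()) , (λ ()) , (λ ())
    extractBasis {suc n} v with extractBasis (v ∘ suc)
    ... | d , d≤n , b , ind , v⊆b , b⊆v with span? b (v zero)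
    ...   | yes v₀∈b = d , ℕ.m≤n⇒m≤1+n d≤n , b , ind ,
              (λ { zero → v₀∈b ; (suc i) → v⊆b i }) , (λ i → span-tail v (b⊆v i))
    ...   | no  v₀∉b = suc d , s≤s d≤n , (v zero Vector.∷ b) , independent-extend ind v₀∉b ,
              (λ { zero → span-head (v zero Vector.∷ b) ; (suc i) → span-tail (v zero Vector.∷ b) (v⊆b i) }) ,
              (λ { zero → span-head v ; (suc i) → span-tail v (b⊆v i) })

vectorSemimodule : (R : CommutativeRing c ℓ) → ℕ → LeftSemimodule (CommutativeRing.semiring R) c ℓ
vectorSemimodule R r = record
  { Carrierᴹ = Vector Carrier r
  ; _≈ᴹ_     = _≋_
  ; _+ᴹ_     = Vector.zipWith _+_
  ; _*ₗ_     = λ x → Vector.map (x *_)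
  ; 0ᴹ       = Vector.replicate r 0#
  ; isLeftSemimodule = record
    { +ᴹ-isCommutativeMonoid = record
      { isMonoid = record
        { isSemigroup = record
          { isMagma = record
            { isEquivalence = ≋-isEquivalence r
            ; ∙-cong        = λ p q i → +-cong (p i) (q i)
            }
          ; assoc = λ u v w i → +-assoc (u i) (v i) (w i)
          }
        ; identity = (λ v i → +-identityˡ (v i)) , (λ v i → +-identityʳ (v i))
        }
      ; comm = λ v w i → +-comm (v i) (w i)
      }
    ; isPreleftSemimodule = record
      { *ₗ-cong      = λ p q i → *-cong p (q i)
      ; *ₗ-zeroˡ     = λ v i → zeroˡ (v i)
      ; *ₗ-distribʳ  = λ v x y i → distribʳ (v i) x y
      ; *ₗ-identityˡ = λ v i → *-identityˡ (v i)
      ; *ₗ-assoc     = λ x y v i → *-assoc x y (v i)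
      ; *ₗ-zeroʳ     = λ x i → zeroʳ x
      ; *ₗ-distribˡ  = λ x v w i → distribˡ x (v i) (w i)
      }
    }
  }
  where
  open CommutativeRing R hiding (zero)
  open VecEquality setoid

module DotProduct (R : CommutativeRing c ℓ) where
  open CommutativeRing R hiding (zero)
  open VecEquality setoid
  open Algebra.Properties.Semiring.Sum semiring
  open SetoidReasoning setoid

  infix 7 _∙_
  _∙_ : Vector Carrier n → Vector Carrier n → Carrier
  v ∙ w = sum (λ i → v i * w i)

  module _ {r : ℕ} where
    open LinearCombination R (vectorSemimodule R r) public

    -- Bridge between `lc`, which adds vectors, and the coordinatewise sums in `linearCombination`.
    lc-pointwise : ∀ {k} (a : Vector Carrier k) (v : Vector (Vector Carrier r) k) j →
                   lc a v j ≈ sum (λ i → a i * v i j)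
    lc-pointwise {zero}  a v j = refl
    lc-pointwise {suc k} a v j = +-congˡ (lc-pointwise (a ∘ suc) (v ∘ suc) j)

    ∙-zero : ∀ {v : Vector Carrier r} w → (∀ i → v i ≈ 0#) → v ∙ w ≈ 0#
    ∙-zero {v} w v≋0 = trans (sum-cong-≋ (λ i → trans (*-congʳ (v≋0 i)) (zeroˡ (w i)))) (sum-replicate-zero r)

    ∙-cong : ∀ {v v′ w w′ : Vector Carrier r} → v ≋ v′ → w ≋ w′ → v ∙ w ≈ v′ ∙ w′
    ∙-cong p q = sum-cong-≋ (λ i → *-cong (p i) (q i))

    ∙-+ : ∀ (u v w : Vector Carrier r) → u ∙ (λ i → v i + w i) ≈ u ∙ v + u ∙ w
    ∙-+ u v w = trans (sum-cong-≋ (λ i → distribˡ (u i) (v i) (w i)))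
                      (∑-distrib-+ (λ i → u i * v i) (λ i → u i * w i))

    ∙-* : ∀ x (u v : Vector Carrier r) → u ∙ (λ i → x * v i) ≈ x * (u ∙ v)
    ∙-* x u v = trans
      (sum-cong-≋ (λ i → trans (sym (*-assoc (u i) x (v i))) (trans (*-congʳ (*-comm (u i) x)) (*-assoc x (u i) (v i)))))
      (sym (*-distribˡ-sum x (λ i → u i * v i)))

    ∙-comm : ∀ (u v : Vector Carrier r) → u ∙ v ≈ v ∙ u
    ∙-comm u v = sum-cong-≋ (λ i → *-comm (u i) (v i))

    ∙-lc : ∀ {k} (u : Vector Carrier r) (a : Vector Carrier k) v → (∀ i → u ∙ v i ≈ 0#) → u ∙ lc a v ≈ 0#
    ∙-lc u = lc-closed (λ w → u ∙ w ≈ 0#)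
      (trans (∙-comm u _) (∙-zero u (λ _ → refl)))
      (λ p q → trans (∙-+ u _ _) (trans (+-cong p q) (+-identityˡ 0#)))
      (λ x p → trans (∙-* x u _) (trans (*-congˡ p) (zeroʳ x)))

  -- Pigeonhole: two distinct vectors have the same products with all the g i, as q ^ k < q ^ r.
  annihilator : ∀ {q} → IsFiniteField R q → ∀ {k r} → k ℕ.< r → (g : Vector (Vector Carrier r) k) →
                ∃[ φ ] ((∀ i → φ ∙ g i ≈ 0#) × ¬ (∀ j → φ j ≈ 0#))
  annihilator {q} isField {k} {r} k<r g = φ , φ⊥g , φ≉0
    where
    open IsFiniteField isField
    open Algebra.Properties.Group +-group using (x∙y⁻¹≈ε⇒x≈y)
    open Algebra.Properties.Ring ring using (-‿distribˡ-*)
    module Eʳ = Inverse (vectorEnum enumeration r)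
    module Eᵏ = Inverse (vectorEnum enumeration k)
    products : Vector Carrier r → Vector Carrier k
    products v i = v ∙ g i

    collision = Fin.pigeonhole (ℕ.^-monoʳ-< q order>1 k<r) (λ i → Eᵏ.to (products (Eʳ.from i)))
    i = proj₁ collision
    j = proj₁ (proj₂ collision)
    v = Eʳ.from i
    w = Eʳ.from j

    products≋ : ∀ l → v ∙ g l ≈ w ∙ g l
    products≋ l = trans (sym (Eᵏ.strictlyInverseʳ (products v) l))
      (trans (Eᵏ.from-cong (proj₂ (proj₂ (proj₂ collision))) l) (Eᵏ.strictlyInverseʳ (products w) l))

    -- The difference of the two colliding vectors, with the sign as a scalar so that `∙-*` applies.
    φ : Vector Carrier r
    φ t = v t + - 1# * w t

    φ⊥g : ∀ l → φ ∙ g l ≈ 0#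
    φ⊥g l = begin
      φ ∙ g l                          ≈⟨ ∙-comm φ (g l) ⟩
      g l ∙ φ                          ≈⟨ ∙-+ (g l) v _ ⟩
      g l ∙ v + g l ∙ (λ t → - 1# * w t) ≈⟨ +-cong (∙-comm (g l) v) (∙-* (- 1#) (g l) w) ⟩
      v ∙ g l + - 1# * (g l ∙ w)       ≈⟨ +-cong (products≋ l) (*-congˡ (∙-comm (g l) w)) ⟩
      w ∙ g l + - 1# * (w ∙ g l)       ≈⟨ +-congˡ (trans (sym (-‿distribˡ-* 1# _)) (-‿cong (*-identityˡ _))) ⟩
      w ∙ g l + - (w ∙ g l)            ≈⟨ -‿inverseʳ _ ⟩
      0# ∎

    φ≉0 : ¬ (∀ t → φ t ≈ 0#)
    φ≉0 φ≋0 = Fin.<⇒≢ (proj₁ (proj₂ (proj₂ collision)))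
      (≡.trans (≡.sym (Eʳ.strictlyInverseˡ i)) (≡.trans (Eʳ.to-cong v≋w) (Eʳ.strictlyInverseˡ j)))
      where
      v≋w : v ≋ w
      v≋w t = x∙y⁻¹≈ε⇒x≈y (v t) (w t)
        (trans (+-congˡ (trans (-‿cong (sym (*-identityˡ (w t)))) (-‿distribˡ-* 1# (w t)))) (φ≋0 t))

-- Finite fields and the Frobenius map

prime∤! : ∀ {p} → Prime p → ∀ k → k ℕ.< p → p ∤ k ℕ.!
prime∤! {p} pr zero    _ p∣1 = ℕ.<⇒≱ (ℕ.nonTrivial⇒n>1 p {{prime⇒nonTrivial pr}}) (∣⇒≤ p∣1)
prime∤! pr (suc k) k<p p∣ with euclidsLemma (suc k) (k ℕ.!) pr p∣
... | inj₁ p∣1+k = ℕ.<⇒≱ k<p (∣⇒≤ p∣1+k)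
... | inj₂ p∣k!  = prime∤! pr k (ℕ.<-trans (ℕ.n<1+n k) k<p) p∣k!

C*[k!*[n∸k]!]≡n! : ∀ {n k} → k ℕ.≤ n → (n C k) ℕ.* (k ℕ.! ℕ.* (n ℕ.∸ k) ℕ.!) ≡ n ℕ.!
C*[k!*[n∸k]!]≡n! {n} {k} k≤n = ≡.trans
  (≡.cong (ℕ._* (k ℕ.! ℕ.* (n ℕ.∸ k) ℕ.!)) (nCk≡n!/k![n-k]! k≤n))
  (m/n*n≡m {{ℕ._!*_!≢0 k (n ℕ.∸ k)}} (k![n∸k]!∣n! k≤n))

-- `p` divides `p !`, the product of `p C k`, `k !` and `(p ∸ k) !`, but neither of the two
-- factorials.
prime∣C : ∀ {p k} → Prime p → 0 ℕ.< k → k ℕ.< p → p ∣ p C k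
prime∣C {p@(suc p′)} {k} pr 0<k k<p
  with euclidsLemma (p C k) (k ℕ.! ℕ.* (p ℕ.∸ k) ℕ.!) pr
         (≡.subst (p ∣_) (≡.sym (C*[k!*[n∸k]!]≡n! (ℕ.<⇒≤ k<p))) (m∣m*n (p′ ℕ.!)))
... | inj₁ p∣C = p∣C
... | inj₂ p∣k!*l! with euclidsLemma (k ℕ.!) ((p ℕ.∸ k) ℕ.!) pr p∣k!*l!
...   | inj₁ p∣k! = contradiction p∣k! (prime∤! pr k k<p)
...   | inj₂ p∣l! = contradiction p∣l! (prime∤! pr (p ℕ.∸ k) (ℕ.∸-monoʳ-< 0<k (ℕ.<⇒≤ k<p)))

module Frobenius (R : CommutativeRing c ℓ) where
  open CommutativeRing R hiding (zero)
  open Algebra.Properties.Semiring.Mult semiring renaming (_×_ to infixr 8 _·_)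
  open Algebra.Properties.Semiring.Exp semiring
  open Algebra.Properties.Semiring.Sum semiring
  open Algebra.Properties.CommutativeSemiring.Binomial commutativeSemiring
  open SetoidReasoning setoid

  ∣⇒·≈0 : ∀ {p n} → p · 1# ≈ 0# → p ∣ n → ∀ x → n · x ≈ 0#
  ∣⇒·≈0 {p} {n} p·1≈0 (divides k ≡.refl) x = begin
    (k ℕ.* p) · x         ≈⟨ ×-assocˡ x k p ⟨
    k · (p · x)           ≈⟨ ×-congʳ k (×-congʳ p (*-identityˡ x)) ⟨
    k · (p · (1# * x))    ≈⟨ ×-congʳ k (×-assoc-* p 1# x) ⟨
    k · (p · 1# * x)      ≈⟨ ×-congʳ k (trans (*-congʳ p·1≈0) (zeroˡ x)) ⟩
    k · 0#                ≈⟨ trans (×-congʳ k (sym (*-identityˡ 0#))) (trans (sym (×-assoc-* k 1# 0#)) (zeroʳ _)) ⟩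
    0#                    ∎

  -- All inner coefficients of the binomial expansion are multiples of `p`, so only its two end
  -- terms survive.
  frobenius : ∀ {p} → Prime p → p · 1# ≈ 0# → ∀ x y → (x + y) ^ p ≈ x ^ p + y ^ p
  frobenius {zero}           pr = contradiction (prime⇒nonZero pr) λ ()
  frobenius {suc zero}       pr = contradiction (prime⇒nonTrivial pr) λ ()
  frobenius {p@(suc p′@(suc _))} pr p·1≈0 x y = begin
    (x + y) ^ p
      ≈⟨ theorem p x y ⟩
    binomialTerm x y p zero + sum (λ i → binomialTerm x y p (suc i))
      ≈⟨ +-congˡ (sum-init-last (λ i → binomialTerm x y p (suc i))) ⟩
    binomialTerm x y p zero + (sum (λ i → binomialTerm x y p (suc (inject₁ i))) + binomialTerm x y p (suc (fromℕ p′)))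
      ≈⟨ +-congˡ (+-congʳ (trans (sum-cong-≋ middle≈0) (sum-replicate-zero p′))) ⟩
    binomialTerm x y p zero + (0# + binomialTerm x y p (suc (fromℕ p′)))
      ≈⟨ +-cong (trans (×-homo-1 _) (*-identityˡ _)) (trans (+-identityˡ _) last≈) ⟩
    y ^ p + x ^ p
      ≈⟨ +-comm _ _ ⟩
    x ^ p + y ^ p ∎
    where
    middle≈0 : ∀ i → binomialTerm x y p (suc (inject₁ i)) ≈ 0#
    middle≈0 i = ∣⇒·≈0 p·1≈0
      (prime∣C pr (s≤s z≤n) (s≤s (≡.subst (ℕ._< p′) (≡.sym (Fin.toℕ-inject₁ i)) (Fin.toℕ<n i)))) _

    -- The index is generalized because `suc (toℕ (fromℕ p′))` equals `p` only propositionally.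
    top : ∀ {k} → k ≡ p → (p C k) · (x ^ k * y ^ (p ℕ.∸ k)) ≈ x ^ p
    top ≡.refl = begin
      (p C p) · (x ^ p * y ^ (p ℕ.∸ p))  ≈⟨ ×-cong (nCn≡1 p) (*-congˡ (^-congʳ y (ℕ.n∸n≡0 p))) ⟩
      1 · (x ^ p * 1#)                    ≈⟨ ×-homo-1 _ ⟩
      x ^ p * 1#                          ≈⟨ *-identityʳ _ ⟩
      x ^ p                               ∎

    last≈ : binomialTerm x y p (suc (fromℕ p′)) ≈ x ^ p
    last≈ = top (≡.cong suc (Fin.toℕ-fromℕ p′))

  frobenius-iterate : ∀ {p} → Prime p → p · 1# ≈ 0# → ∀ k x y →
                      (x + y) ^ (p ℕ.^ k) ≈ x ^ (p ℕ.^ k) + y ^ (p ℕ.^ k)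
  frobenius-iterate pr p·1≈0 zero    x y =
    trans (*-identityʳ _) (+-cong (sym (*-identityʳ x)) (sym (*-identityʳ y)))
  frobenius-iterate {p} pr p·1≈0 (suc k) x y = begin
    (x + y) ^ (p ℕ.* p ℕ.^ k)                        ≈⟨ ^-assocʳ (x + y) p _ ⟨
    ((x + y) ^ p) ^ (p ℕ.^ k)                        ≈⟨ ^-congˡ (p ℕ.^ k) (frobenius pr p·1≈0 x y) ⟩
    (x ^ p + y ^ p) ^ (p ℕ.^ k)                      ≈⟨ frobenius-iterate pr p·1≈0 k _ _ ⟩
    (x ^ p) ^ (p ℕ.^ k) + (y ^ p) ^ (p ℕ.^ k)        ≈⟨ +-cong (^-assocʳ x p _) (^-assocʳ y p _) ⟩
    x ^ (p ℕ.* p ℕ.^ k) + y ^ (p ℕ.* p ℕ.^ k)        ∎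

module FiniteField {R : CommutativeRing c ℓ} {q} (isField : IsFiniteField R q) where
  open CommutativeRing R hiding (zero)
  open IsFiniteField isField public
  open Inverse enumeration using (to; from; to-cong; from-cong; strictlyInverseˡ; strictlyInverseʳ)
  open Algebra.Properties.Semiring.Mult semiring renaming (_×_ to infixr 8 _·_)
  open Algebra.Properties.Semiring.Exp semiring
  open Algebra.Properties.CommutativeSemiring.Exp commutativeSemiring using (^-distrib-*)
  open Algebra.Properties.Group +-group using (∙-cancelˡ)
  open SetoidReasoning setoid
  private
    module Sum = Algebra.Properties.CommutativeMonoid.Sum +-commutativeMonoid
    module Product = Algebra.Properties.CommutativeMonoid.Sum *-commutativeMonoid

  *-cancelˡ-unit : ∀ {x y z w} → x * w ≈ 1# → x * y ≈ x * z → y ≈ z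
  *-cancelˡ-unit {x} {y} {z} {w} xw≈1 xy≈xz = begin
    y             ≈⟨ expand y ⟩
    w * (x * y)   ≈⟨ *-congˡ xy≈xz ⟩
    w * (x * z)   ≈⟨ expand z ⟨
    z             ∎
    where
    expand : ∀ t → t ≈ w * (x * t)
    expand t = sym (trans (sym (*-assoc w x t)) (trans (*-congʳ (trans (*-comm w x) xw≈1)) (*-identityˡ t)))

  noZeroDivisors : ∀ {x y} → x * y ≈ 0# → x ≈ 0# ⊎ y ≈ 0#
  noZeroDivisors {x} {y} xy≈0 with zeroOrUnit x
  ... | inj₁ x≈0          = inj₁ x≈0
  ... | inj₂ (w , xw≈1) = inj₂ (*-cancelˡ-unit xw≈1 (trans xy≈0 (sym (zeroʳ x))))

  private
    permutation : (f g : Carrier → Carrier) → (∀ {x y} → x ≈ y → f x ≈ f y) →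
                  (∀ {x y} → x ≈ y → g x ≈ g y) → (∀ x → f (g x) ≈ x) → (∀ x → g (f x) ≈ x) →
                  Fin q ↔ Fin q
    permutation f g f-cong g-cong fg gf = mk↔ₛ′ (to ∘ f ∘ from) (to ∘ g ∘ from)
      (λ i → ≡.trans (to-cong (trans (f-cong (strictlyInverseʳ _)) (fg _))) (strictlyInverseˡ i))
      (λ i → ≡.trans (to-cong (trans (g-cong (strictlyInverseʳ _)) (gf _))) (strictlyInverseˡ i))

  -- Translation by 1 permutes the field, so it does not change the sum of all elements.
  order·1≈0 : q · 1# ≈ 0#
  order·1≈0 = ∙-cancelˡ (Sum.sum from) _ _ (begin
    Sum.sum from + q · 1#              ≈⟨ +-congˡ (Sum.sum-replicate q) ⟨
    Sum.sum from + Sum.sum (Vector.replicate q 1#) ≈⟨ Sum.∑-distrib-+ from (λ _ → 1#) ⟨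
    Sum.sum (λ i → from i + 1#)        ≈⟨ Sum.sum-cong-≋ (λ i → strictlyInverseʳ (from i + 1#)) ⟨
    Sum.sum (λ i → from (to (from i + 1#))) ≈⟨ Sum.sum-permute from shift ⟨
    Sum.sum from                       ≈⟨ +-identityʳ _ ⟨
    Sum.sum from + 0#                  ∎)
    where
    shift : Fin q ↔ Fin q
    shift = permutation (_+ 1#) (_+ - 1#) +-congʳ +-congʳ
      (λ x → trans (+-assoc x _ _) (trans (+-congˡ (-‿inverseˡ 1#)) (+-identityʳ x)))
      (λ x → trans (+-assoc x _ _) (trans (+-congˡ (-‿inverseʳ 1#)) (+-identityʳ x)))

  -- If `p · 1#` were a unit, so would be its `k`-th power, which is `q · 1# ≈ 0#`.
  characteristic : ∀ {p k} → q ≡ p ℕ.^ k → p · 1# ≈ 0#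
  characteristic {p} {k} q≡p^k with zeroOrUnit (p · 1#)
  ... | inj₁ p·1≈0          = p·1≈0
  ... | inj₂ (w , p·1*w≈1) = contradiction
    (begin
      1#                            ≈⟨ 1^ k ⟨
      1# ^ k                        ≈⟨ ^-congˡ k p·1*w≈1 ⟨
      (p · 1# * w) ^ k              ≈⟨ ^-distrib-* (p · 1#) w k ⟩
      (p · 1#) ^ k * w ^ k          ≈⟨ *-congʳ (·1-homo-^ k) ⟨
      (p ℕ.^ k) · 1# * w ^ k        ≡⟨ ≡.cong (λ n → n · 1# * w ^ k) q≡p^k ⟨
      q · 1# * w ^ k                ≈⟨ trans (*-congʳ order·1≈0) (zeroˡ _) ⟩
      0#                            ∎)
    1≉0
    where
    1^ : ∀ k → 1# ^ k ≈ 1#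
    1^ zero    = refl
    1^ (suc k) = trans (*-identityˡ _) (1^ k)
    ·1-homo-^ : ∀ k → (p ℕ.^ k) · 1# ≈ (p · 1#) ^ k
    ·1-homo-^ zero    = ×-homo-1 1#
    ·1-homo-^ (suc k) = trans (×1-homo-* p (p ℕ.^ k)) (*-congˡ (·1-homo-^ k))

  order≢0 : q ≢ 0
  order≢0 q≡0 with () ← ≡.subst Fin q≡0 (to 0#)

  -- Multiplication by a unit a permutes the nonzero elements, whose product is a unit.
  fermat : ∀ a → a ^ q ≈ a
  fermat a with zeroOrUnit a
  ... | inj₁ a≈0 = trans (^-congˡ q a≈0) (trans (0^ q order≢0) (sym a≈0))
    where
    0^ : ∀ n → n ≢ 0 → 0# ^ n ≈ 0#
    0^ zero    n≢0 = contradiction ≡.refl n≢0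
    0^ (suc n) _   = zeroˡ _
  ... | inj₂ (a⁻¹ , aa⁻¹≈1) = ^q q ≡.refl
    where
    a⁻¹*a*_ : ∀ x → a⁻¹ * (a * x) ≈ x
    a⁻¹*a* x = trans (sym (*-assoc a⁻¹ a x)) (trans (*-congʳ (trans (*-comm a⁻¹ a) aa⁻¹≈1)) (*-identityˡ x))
    a*a⁻¹*_ : ∀ x → a * (a⁻¹ * x) ≈ x
    a*a⁻¹* x = trans (sym (*-assoc a a⁻¹ x)) (trans (*-congʳ aa⁻¹≈1) (*-identityˡ x))

    scaling : Fin q ↔ Fin q
    scaling = permutation (a *_) (a⁻¹ *_) *-congˡ *-congˡ (a*a⁻¹*_) (a⁻¹*a*_)

    -- Giving the zero element the factor `1#` turns a product over the whole field into one over
    -- the nonzero elements.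
    onNonzero : Carrier → Carrier → Carrier
    onNonzero y x with x ≟ 0#
    ... | yes _ = 1#
    ... | no  _ = y

    onNonzero-0 : ∀ y x → x ≈ 0# → onNonzero y x ≈ 1#
    onNonzero-0 y x x≈0 with x ≟ 0#
    ... | yes _  = refl
    ... | no x≉0 = contradiction x≈0 x≉0

    onNonzero-≉0 : ∀ y x → ¬ x ≈ 0# → onNonzero y x ≈ y
    onNonzero-≉0 y x x≉0 with x ≟ 0#
    ... | yes x≈0 = contradiction x≈0 x≉0
    ... | no _    = refl

    nonzeroPart : Carrier → Carrier
    nonzeroPart x = onNonzero x x

    nonzeroPart-scale : ∀ x y → y ≈ a * x → nonzeroPart y ≈ onNonzero a x * nonzeroPart x
    nonzeroPart-scale x y y≈ax with x ≟ 0#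
    ... | yes x≈0 = trans (onNonzero-0 y y (trans y≈ax (trans (*-congˡ x≈0) (zeroʳ a)))) (sym (*-identityˡ 1#))
    ... | no  x≉0 = trans (onNonzero-≉0 y y y≉0) y≈ax
      where
      y≉0 : ¬ y ≈ 0#
      y≉0 y≈0 = x≉0 (trans (sym (a⁻¹*a*_ x)) (trans (*-congˡ (trans (sym y≈ax) y≈0)) (zeroʳ a⁻¹)))

    nonzeroPart-unit : ∀ x → ∃[ w ] nonzeroPart x * w ≈ 1#
    nonzeroPart-unit x with x ≟ 0# | zeroOrUnit x
    ... | yes _  | _        = 1# , *-identityˡ 1#
    ... | no x≉0 | inj₁ x≈0 = contradiction x≈0 x≉0
    ... | no _   | inj₂ u   = u

    product-unit : ∀ {n} (f : Vector Carrier n) → (∀ i → ∃[ w ] f i * w ≈ 1#) →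
                   ∃[ w ] Product.sum f * w ≈ 1#
    product-unit {zero}  f u = 1# , *-identityˡ 1#
    product-unit {suc n} f u with u zero | product-unit (f ∘ suc) (u ∘ suc)
    ... | w , eq | w′ , eq′ = w * w′ , (begin
      f zero * P * (w * w′)     ≈⟨ *-assoc _ _ _ ⟩
      f zero * (P * (w * w′))   ≈⟨ *-congˡ (trans (*-congˡ (*-comm w w′)) (sym (*-assoc P w′ w))) ⟩
      f zero * (P * w′ * w)     ≈⟨ *-congˡ (trans (*-congʳ eq′) (*-identityˡ w)) ⟩
      f zero * w                ≈⟨ eq ⟩
      1#                        ∎)
      where P = Product.sum (f ∘ suc)

    total : Carrier
    total = Product.sum (nonzeroPart ∘ from)

    product≈1 : Product.sum (onNonzero a ∘ from) ≈ 1#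
    product≈1 = *-cancelˡ-unit (proj₂ (product-unit (nonzeroPart ∘ from) (nonzeroPart-unit ∘ from))) (begin
      total * Product.sum (onNonzero a ∘ from)
        ≈⟨ *-comm _ _ ⟩
      Product.sum (onNonzero a ∘ from) * total
        ≈⟨ Product.∑-distrib-+ (onNonzero a ∘ from) (nonzeroPart ∘ from) ⟨
      Product.sum (λ i → onNonzero a (from i) * nonzeroPart (from i))
        ≈⟨ Product.sum-cong-≋ (λ i → nonzeroPart-scale (from i) _ (strictlyInverseʳ _)) ⟨
      Product.sum (λ i → nonzeroPart (from (to (a * from i))))
        ≈⟨ Product.sum-permute (nonzeroPart ∘ from) scaling ⟨
      total
        ≈⟨ *-identityʳ total ⟨
      total * 1# ∎)

    -- The product of `onNonzero a` has factor `1#` at zero and `a` at the other `q - 1` elements.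
    -- The order is generalized to `n` to expose its predecessor.
    ^q : ∀ n → q ≡ n → a ^ n ≈ a
    ^q zero    q≡0    = contradiction q≡0 order≢0
    ^q (suc n) ≡.refl = trans (*-congˡ (begin
      a ^ n
        ≈⟨ Product.sum-replicate n ⟨
      Product.sum (Vector.replicate n a)
        ≈⟨ Product.sum-cong-≋ nonzero ⟨
      Product.sum (Vector.removeAt f i₀)
        ≈⟨ *-identityˡ _ ⟨
      1# * Product.sum (Vector.removeAt f i₀)
        ≈⟨ *-congʳ (onNonzero-0 a (from i₀) (strictlyInverseʳ 0#)) ⟨
      f i₀ * Product.sum (Vector.removeAt f i₀)
        ≈⟨ Product.sum-remove f ⟨
      Product.sum f
        ≈⟨ product≈1 ⟩
      1# ∎)) (*-identityʳ a)
      where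
      i₀ = to 0#
      f : Vector Carrier (suc n)
      f = onNonzero a ∘ from
      nonzero : ∀ j → Vector.removeAt f i₀ j ≈ a
      nonzero j = onNonzero-≉0 a (from (punchIn i₀ j)) λ eq →
        Fin.punchInᵢ≢i i₀ j (≡.trans (≡.sym (strictlyInverseˡ _)) (to-cong eq))

  fermat-iterate : ∀ k a → a ^ (q ℕ.^ k) ≈ a
  fermat-iterate zero    a = *-identityʳ a
  fermat-iterate (suc k) a = trans (sym (^-assocʳ a q (q ℕ.^ k)))
    (trans (^-congˡ (q ℕ.^ k) (fermat a)) (fermat-iterate k a))

-- The algebra F[X] / (X ^ N - X)

-- A list a₀ ∷ a₁ ∷ … stands for the operator ∑ aᵢ Tⁱ on functions w : Fin N → A, where
-- (T w) i = w (σ i).  Lists are identified when they act equally, so that all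
-- ring laws reduce to laws of linear operators.
module ShiftAlgebra (A : CommutativeRing c ℓ) {N : ℕ} (σ : Fin N → Fin N) where
  open CommutativeRing A hiding (zero)
  open Algebra.Properties.CommutativeSemigroup +-commutativeSemigroup using (interchange)
  open Algebra.Properties.Ring ring using (-‿distribˡ-*)
  open Algebra.Properties.AbelianGroup +-abelianGroup using (⁻¹-∙-comm)
  open Algebra.Properties.Group +-group using (ε⁻¹≈ε)
  open SetoidReasoning setoid

  act : List Carrier → Vector Carrier N → Vector Carrier N
  act []      w i = 0#
  act (a ∷ f) w i = a * w i + act f w (σ i)

  infix  4 _≈ˡ_
  infixl 6 _⊕_
  infixl 7 _⊛_
  infix  8 ⊝_

  _≈ˡ_ : List Carrier → List Carrier → Set _
  f ≈ˡ g = ∀ w i → act f w i ≈ act g w i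

  _⊕_ : List Carrier → List Carrier → List Carrier
  []      ⊕ g       = g
  (a ∷ f) ⊕ []      = a ∷ f
  (a ∷ f) ⊕ (b ∷ g) = a + b ∷ f ⊕ g

  _⊛_ : List Carrier → List Carrier → List Carrier
  []      ⊛ g = []
  (a ∷ f) ⊛ g = List.map (a *_) g ⊕ (0# ∷ f ⊛ g)

  ⊝_ : List Carrier → List Carrier
  ⊝_ = List.map (λ a → - a)

  act-⊕ : ∀ f g w i → act (f ⊕ g) w i ≈ act f w i + act g w i
  act-⊕ []      g       w i = sym (+-identityˡ _)
  act-⊕ (a ∷ f) []      w i = sym (+-identityʳ _)
  act-⊕ (a ∷ f) (b ∷ g) w i = trans
    (+-cong (distribʳ (w i) a b) (act-⊕ f g w (σ i)))
    (interchange _ _ _ _)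

  act-scale : ∀ a f w i → act (List.map (a *_) f) w i ≈ a * act f w i
  act-scale a []      w i = sym (zeroʳ a)
  act-scale a (b ∷ f) w i = trans
    (+-cong (*-assoc a b (w i)) (act-scale a f w (σ i)))
    (sym (distribˡ a _ _))

  act-neg : ∀ f w i → act (⊝ f) w i ≈ - act f w i
  act-neg []      w i = sym ε⁻¹≈ε
  act-neg (a ∷ f) w i = trans
    (+-cong (sym (-‿distribˡ-* a (w i))) (act-neg f w (σ i)))
    (⁻¹-∙-comm _ _)

  act-⊛ : ∀ f g w i → act (f ⊛ g) w i ≈ act f (act g w) i
  act-⊛ []      g w i = refl
  act-⊛ (a ∷ f) g w i = trans (act-⊕ (List.map (a *_) g) _ w i)
    (+-cong (act-scale a g w i)
      (trans (+-cong (zeroˡ (w i)) (act-⊛ f g w (σ i))) (+-identityˡ _)))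

  act-cong : ∀ f {w w′} → (∀ i → w i ≈ w′ i) → ∀ i → act f w i ≈ act f w′ i
  act-cong []      w≋w′ i = refl
  act-cong (a ∷ f) w≋w′ i = +-cong (*-congˡ (w≋w′ i)) (act-cong f w≋w′ (σ i))

  act-+ : ∀ f v w i → act f (λ j → v j + w j) i ≈ act f v i + act f w i
  act-+ []      v w i = sym (+-identityˡ 0#)
  act-+ (a ∷ f) v w i = trans
    (+-cong (distribˡ a (v i) (w i)) (act-+ f v w (σ i)))
    (interchange _ _ _ _)

  act-* : ∀ f a w i → act f (λ j → a * w j) i ≈ a * act f w i
  act-* []      a w i = sym (zeroʳ a)
  act-* (b ∷ f) a w i = trans
    (+-cong
      (trans (sym (*-assoc b a (w i))) (trans (*-congʳ (*-comm b a)) (*-assoc a b (w i))))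
      (act-* f a w (σ i)))
    (sym (distribˡ a _ _))

  act-shift : ∀ f w i → act f (w ∘ σ) i ≈ act f w (σ i)
  act-shift []      w i = refl
  act-shift (a ∷ f) w i = +-congˡ (act-shift f w (σ i))

  act-0 : ∀ f i → act f (λ _ → 0#) i ≈ 0#
  act-0 f i = trans (act-cong f (λ _ → sym (zeroˡ 0#)) i) (trans (act-* f 0# (λ _ → 0#) i) (zeroˡ _))

  -- Both are polynomials in the same shift, and every `act g` commutes with scalars and with that
  -- shift.
  act-comm : ∀ f g w i → act f (act g w) i ≈ act g (act f w) i
  act-comm []      g w i = sym (act-0 g i)
  act-comm (a ∷ f) g w i = begin
    a * act g w i + act f (act g w) (σ i)
      ≈⟨ +-cong (sym (act-* g a w i)) (trans (act-comm f g w (σ i)) (sym (act-shift g (act f w) i))) ⟩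
    act g (λ j → a * w j) i + act g (act f w ∘ σ) i
      ≈⟨ act-+ g _ _ i ⟨
    act g (act (a ∷ f) w) i ∎

  ι : Carrier → List Carrier
  ι a = a ∷ []

  act-ι : ∀ a w i → act (ι a) w i ≈ a * w i
  act-ι a w i = +-identityʳ _

  X : List Carrier
  X = 0# ∷ 1# ∷ []

  act-X : ∀ w i → act X w i ≈ w (σ i)
  act-X w i = begin
    0# * w i + (1# * w (σ i) + 0#)  ≈⟨ +-cong (zeroˡ _) (+-identityʳ _) ⟩
    0# + 1# * w (σ i)               ≈⟨ +-identityˡ _ ⟩
    1# * w (σ i)                    ≈⟨ *-identityˡ _ ⟩
    w (σ i)                         ∎

  shiftAlgebra : CommutativeRing c (c ⊔ ℓ)
  shiftAlgebra = record
    { Carrier = List Carrier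
    ; _≈_ = _≈ˡ_
    ; _+_ = _⊕_
    ; _*_ = _⊛_
    ; -_  = ⊝_
    ; 0#  = []
    ; 1#  = ι 1#
    ; isCommutativeRing = record
      { isRing = record
        { +-isAbelianGroup = record
          { isGroup = record
            { isMonoid = record
              { isSemigroup = record
                { isMagma = record
                  { isEquivalence = record
                    { refl  = λ w i → refl
                    ; sym   = λ p w i → sym (p w i)
                    ; trans = λ p q w i → trans (p w i) (q w i)
                    }
                  ; ∙-cong = λ {f} {f′} {g} {g′} p q w i → trans (act-⊕ f g w i)
                      (trans (+-cong (p w i) (q w i)) (sym (act-⊕ f′ g′ w i)))
                  }
                ; assoc = λ f g h w i → trans (act-⊕ (f ⊕ g) h w i)
                    (trans (+-congʳ (act-⊕ f g w i))
                      (trans (+-assoc _ _ _)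
                        (sym (trans (act-⊕ f (g ⊕ h) w i) (+-congˡ (act-⊕ g h w i))))))
                }
              ; identity = (λ f w i → refl) , (λ f w i → trans (act-⊕ f [] w i) (+-identityʳ _))
              }
            ; inverse =
                (λ f w i → trans (act-⊕ (⊝ f) f w i) (trans (+-congʳ (act-neg f w i)) (-‿inverseˡ _))) ,
                (λ f w i → trans (act-⊕ f (⊝ f) w i) (trans (+-congˡ (act-neg f w i)) (-‿inverseʳ _)))
            ; ⁻¹-cong = λ {f} {g} p w i → trans (act-neg f w i) (trans (-‿cong (p w i)) (sym (act-neg g w i)))
            }
          ; comm = λ f g w i → trans (act-⊕ f g w i) (trans (+-comm _ _) (sym (act-⊕ g f w i)))
          }
        ; *-cong = λ {f} {f′} {g} {g′} p q w i → trans (act-⊛ f g w i)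
            (trans (act-cong f (q w) i) (trans (p (act g′ w) i) (sym (act-⊛ f′ g′ w i))))
        ; *-assoc = λ f g h w i → trans (act-⊛ (f ⊛ g) h w i)
            (trans (act-⊛ f g (act h w) i)
              (sym (trans (act-⊛ f (g ⊛ h) w i) (act-cong f (act-⊛ g h w) i))))
        ; *-identity =
            (λ f w i → trans (act-⊛ (ι 1#) f w i) (act-1 (act f w) i)) ,
            (λ f w i → trans (act-⊛ f (ι 1#) w i) (act-cong f (act-1 w) i))
        ; distrib =
            (λ f g h w i → trans (act-⊛ f (g ⊕ h) w i)
              (trans (act-cong f (act-⊕ g h w) i)
                (trans (act-+ f _ _ i)
                  (sym (trans (act-⊕ (f ⊛ g) (f ⊛ h) w i) (+-cong (act-⊛ f g w i) (act-⊛ f h w i))))))) ,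
            (λ f g h w i → trans (act-⊛ (g ⊕ h) f w i)
              (trans (act-⊕ g h (act f w) i)
                (sym (trans (act-⊕ (g ⊛ f) (h ⊛ f) w i) (+-cong (act-⊛ g f w i) (act-⊛ h f w i))))))
        }
      ; *-comm = λ f g w i → trans (act-⊛ f g w i) (trans (act-comm f g w i) (sym (act-⊛ g f w i)))
      }
    }
    where
    act-1 : ∀ w i → act (ι 1#) w i ≈ w i
    act-1 w i = trans (act-ι 1# w i) (*-identityˡ (w i))

  private module R = CommutativeRing shiftAlgebra
  open Algebra.Properties.Semiring.Exp R.semiring using (_^_)

  ι-homomorphism : SemiringMorphisms.IsSemiringHomomorphism
                     (Semiring.rawSemiring semiring) (Semiring.rawSemiring R.semiring) ι
  ι-homomorphism = record
    { isNearSemiringHomomorphism = record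
      { +-isMonoidHomomorphism = record
        { isMagmaHomomorphism = record
          { isRelHomomorphism = record { cong = λ a≈b w i → +-congʳ (*-congʳ a≈b) }
          ; homo = λ a b w i → refl
          }
        ; ε-homo = λ w i → trans (act-ι 0# w i) (zeroˡ (w i))
        }
      ; *-homo = λ a b w i → trans (act-ι (a * b) w i) (trans (*-assoc a b (w i))
          (sym (trans (act-⊛ (ι a) (ι b) w i) (trans (act-ι a (act (ι b) w) i) (*-congˡ (act-ι b w i))))))
      }
    ; 1#-homo = λ w i → refl
    }

  ∷-expand : ∀ a f → a ∷ f ≈ˡ ι a ⊕ X ⊛ f
  ∷-expand a f w i = sym (trans (act-⊕ (ι a) (X ⊛ f) w i)
    (+-cong (act-ι a w i) (trans (act-⊛ X f w i) (act-X (act f w) i))))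

  act-X^ : ∀ j w i → act (X ^ j) w i ≈ w (iterate σ i j)
  act-X^ zero    w i = trans (act-ι 1# w i) (*-identityˡ (w i))
  act-X^ (suc j) w i = trans (act-⊛ X (X ^ j) w i) (trans (act-X (act (X ^ j) w) i) (act-X^ j w (σ i)))

  -- Relations between powers of `X` are inherited from the iterates of `σ`; this will give
  -- `X ^ N ≈ X`.
  X^-cong : ∀ j k → (∀ i → iterate σ i j ≡ iterate σ i k) → X ^ j ≈ˡ X ^ k
  X^-cong j k eq w i = trans (act-X^ j w i) (trans (reflexive (≡.cong w (eq i))) (sym (act-X^ k w i)))

  ≈ˡ-dec : ∀ {q} → IsFiniteField A q → Decidable₂ _≈ˡ_
  ≈ˡ-dec isField f g = finite-all? (vectorEnum enumeration N)
    (λ w≋w′ eq i → trans (sym (act-cong f w≋w′ i)) (trans (eq i) (act-cong g w≋w′ i)))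
    (λ w → Fin.all? (λ i → act f w i ≟ act g w i))
    where open IsFiniteField isField

  -- act f w o = ∑ aᵢ w (σⁱ o) only involves the coefficients aᵢ with i ≥ d if w vanishes on σʲ o for j < d;
  -- a monic polynomial f of degree d then has value w (σᵈ o).
  Monic : Fin N → ℕ → List Carrier → Set _
  Monic o d f = ∀ w → (∀ j → j ℕ.< d → w (iterate σ o j) ≈ 0#) → act f w o ≈ w (iterate σ o d)

  monic-1 : ∀ o → Monic o 0 R.1#
  monic-1 o w _ = act-X^ 0 w o

  iterate-iterate : ∀ j k i → iterate σ (iterate σ i j) k ≡ iterate σ i (j ℕ.+ k)
  iterate-iterate zero    k i = ≡.refl
  iterate-iterate (suc j) k i = iterate-iterate j k (σ i)

  -- `act g w` vanishes at the first `d` points of the orbit, so `f` sees only its value at step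
  -- `d`. There the `X` term reads step `d + 1 < d + k`, where `w` is zero.
  monic-* : ∀ o d k f → 1 ℕ.< k → Monic o d f → Monic o (d ℕ.+ k) (f ⊛ (X ^ k ⊕ ⊝ X))
  monic-* o d k f 1<k monic w w≈0 = begin
    act (f ⊛ g) w o                                  ≈⟨ act-⊛ f g w o ⟩
    act f (act g w) o                                ≈⟨ monic (act g w) low ⟩
    act g w (iterate σ o d)                        ≈⟨ act-g d ⟩
    w (iterate σ o (d ℕ.+ k)) + - w (iterate σ o (d ℕ.+ 1))
      ≈⟨ +-congˡ (trans (-‿cong (w≈0 (d ℕ.+ 1) (ℕ.+-monoʳ-< d 1<k))) ε⁻¹≈ε) ⟩
    w (iterate σ o (d ℕ.+ k)) + 0#                 ≈⟨ +-identityʳ _ ⟩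
    w (iterate σ o (d ℕ.+ k))                      ∎
    where
    g = X ^ k ⊕ ⊝ X
    act-g : ∀ j → act g w (iterate σ o j) ≈ w (iterate σ o (j ℕ.+ k)) + - w (iterate σ o (j ℕ.+ 1))
    act-g j = trans (act-⊕ (X ^ k) (⊝ X) w _) (+-cong
      (trans (act-X^ k w _) (reflexive (≡.cong w (iterate-iterate j k o))))
      (trans (act-neg X w _) (-‿cong (trans (act-X w _) (reflexive (≡.cong w (iterate-iterate j 1 o)))))))
    low : ∀ j → j ℕ.< d → act g w (iterate σ o j) ≈ 0#
    low j j<d = trans (act-g j) (trans
      (+-cong (w≈0 (j ℕ.+ k) (ℕ.+-monoˡ-< k j<d))
              (trans (-‿cong (w≈0 (j ℕ.+ 1) (ℕ.+-mono-< j<d 1<k))) ε⁻¹≈ε))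
      (+-identityˡ 0#))

  -- The operator is tested on the indicator function of step `d` of the orbit, which vanishes at
  -- all earlier steps.
  monic≉0 : ∀ {o d f} → ¬ 1# ≈ 0# → Monic o d f →
            (∀ j → j ℕ.< d → iterate σ o j ≢ iterate σ o d) → ¬ f ≈ˡ []
  monic≉0 {o} {d} {f} 1≉0 monic distinct f≈0 = 1≉0 (begin
    1#         ≈⟨ δ-one _ ≡.refl ⟨
    δ t        ≈⟨ monic δ (λ j j<d → δ-zero _ (distinct j j<d)) ⟨
    act f δ o  ≈⟨ f≈0 δ o ⟩
    0#         ∎)
    where
    t = iterate σ o d
    δ : Vector Carrier N
    δ i with i Fin.≟ t
    ... | yes _ = 1#
    ... | no  _ = 0#
    δ-one : ∀ i → i ≡ t → δ i ≈ 1#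
    δ-one i i≡t with i Fin.≟ t
    ... | yes _   = refl
    ... | no  i≢t = contradiction i≡t i≢t
    δ-zero : ∀ i → i ≢ t → δ i ≈ 0#
    δ-zero i i≢t with i Fin.≟ t
    ... | yes i≡t = contradiction i≡t i≢t
    ... | no  _   = refl

-- Roots of polynomials over a finite field

module Polynomial {R : CommutativeRing c ℓ} {q} (isField : IsFiniteField R q) where
  open CommutativeRing R hiding (zero)
  open FiniteField isField using (noZeroDivisors)
  open Algebra.Properties.Group +-group using (x∙y⁻¹≈ε⇒x≈y)
  open Algebra.Solver.Ring.NaturalCoefficients.Default commutativeSemiring
  open SetoidReasoning setoid

  eval : List Carrier → Carrier → Carrier
  eval []      x = 0#
  eval (a ∷ f) x = a + x * eval f x

  -- Synthetic division by `X - r`: the coefficients are the values at `r` of the successive tails.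
  quotient : Carrier → List Carrier → List Carrier
  quotient r []            = []
  quotient r (a ∷ [])      = []
  quotient r (a ∷ b ∷ f) = eval (b ∷ f) r ∷ quotient r (b ∷ f)

  length-quotient : ∀ r a f → length (quotient r (a ∷ f)) ≡ length f
  length-quotient r a []      = ≡.refl
  length-quotient r a (b ∷ f) = ≡.cong suc (length-quotient r b f)

  -- Writing the point as `r + d` avoids subtraction, so that the solver for commutative semirings
  -- suffices.
  eval-quotient : ∀ r d a f → eval (a ∷ f) (r + d) ≈ eval (a ∷ f) r + d * eval (quotient r (a ∷ f)) (r + d)
  eval-quotient r d a [] = solve 3 (λ r d a →
    a :+ (r :+ d) :* con 0 := (a :+ r :* con 0) :+ d :* con 0) refl r d a
  eval-quotient r d a (b ∷ f) = begin
    a + (r + d) * eval (b ∷ f) (r + d)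
      ≈⟨ +-congˡ (*-congˡ (eval-quotient r d b f)) ⟩
    a + (r + d) * (eval (b ∷ f) r + d * eval (quotient r (b ∷ f)) (r + d))
      ≈⟨ solve 5 (λ a r d E Q → a :+ (r :+ d) :* (E :+ d :* Q)
           := (a :+ r :* E) :+ d :* (E :+ (r :+ d) :* Q)) refl a r d (eval (b ∷ f) r) _ ⟩
    (a + r * eval (b ∷ f) r) + d * (eval (b ∷ f) r + (r + d) * eval (quotient r (b ∷ f)) (r + d)) ∎

  eval-cong : ∀ f {x y} → x ≈ y → eval f x ≈ eval f y
  eval-cong []      x≈y = refl
  eval-cong (a ∷ f) x≈y = +-congˡ (*-cong x≈y (eval-cong f x≈y))

  IsZero : List Carrier → Set _
  IsZero = All (_≈ 0#)

  eval-isZero : ∀ {f} → IsZero f → ∀ x → eval f x ≈ 0#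
  eval-isZero []          x = refl
  eval-isZero (a≈0 ∷ f≈0) x =
    trans (+-cong a≈0 (trans (*-congˡ (eval-isZero f≈0 x)) (zeroʳ x))) (+-identityˡ 0#)

  private
    isZero-head : ∀ {r a} f → eval f r ≈ 0# → eval (a ∷ f) r ≈ 0# → a ≈ 0#
    isZero-head {r} {a} f f≈0 eq = begin
      a                  ≈⟨ +-identityʳ a ⟨
      a + 0#             ≈⟨ +-congˡ (trans (*-congˡ f≈0) (zeroʳ r)) ⟨
      a + r * eval f r   ≈⟨ eq ⟩
      0#                 ∎

  -- The quotient lists the values at `r` of all proper tails. Each coefficient is one such value
  -- minus `r` times the next, hence zero when all of them vanish.
  isZero-quotient : ∀ r a f → eval (a ∷ f) r ≈ 0# → IsZero (quotient r (a ∷ f)) → IsZero (a ∷ f)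
  isZero-quotient r a []      eq []          = isZero-head [] refl eq ∷ []
  isZero-quotient r a (b ∷ f) eq (f≈0 ∷ Q≈0) =
    isZero-head (b ∷ f) f≈0 eq ∷ isZero-quotient r b f f≈0 Q≈0

  -- After division by the first root, the others are roots of the quotient as there are no zero
  -- divisors. The conclusion is about coefficients, not just values.
  manyRoots⇒isZero : ∀ {n} f → length f ℕ.≤ n → (ρ : Vector Carrier n) →
                     (∀ {i j} → ρ i ≈ ρ j → i ≡ j) → (∀ i → eval f (ρ i) ≈ 0#) → IsZero f
  manyRoots⇒isZero {n}     []      _         ρ ρ-inj root = []
  manyRoots⇒isZero {suc n} (a ∷ f) (s≤s |f|) ρ ρ-inj root =
    isZero-quotient r a f (root zero)
      (manyRoots⇒isZero (quotient r (a ∷ f)) (ℕ.≤-trans (ℕ.≤-reflexive (length-quotient r a f)) |f|)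
        (ρ ∘ suc) (Fin.suc-injective ∘ ρ-inj) root′)
    where
    r = ρ zero
    root′ : ∀ i → eval (quotient r (a ∷ f)) (ρ (suc i)) ≈ 0#
    root′ i with noZeroDivisors d*Q≈0
      where
      d = ρ (suc i) + - r
      r+d≈ : r + d ≈ ρ (suc i)
      r+d≈ = trans (+-comm r d) (trans (+-assoc _ _ _) (trans (+-congˡ (-‿inverseˡ r)) (+-identityʳ _)))
      d*Q≈0 : d * eval (quotient r (a ∷ f)) (ρ (suc i)) ≈ 0#
      d*Q≈0 = begin
        d * eval (quotient r (a ∷ f)) (ρ (suc i))   ≈⟨ *-congˡ (eval-cong (quotient r (a ∷ f)) r+d≈) ⟨
        d * eval (quotient r (a ∷ f)) (r + d)       ≈⟨ +-identityˡ _ ⟨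
        0# + d * eval (quotient r (a ∷ f)) (r + d)  ≈⟨ +-congʳ (root zero) ⟨
        eval (a ∷ f) r + d * eval (quotient r (a ∷ f)) (r + d) ≈⟨ eval-quotient r d a f ⟨
        eval (a ∷ f) (r + d)                        ≈⟨ eval-cong (a ∷ f) r+d≈ ⟩
        eval (a ∷ f) (ρ (suc i))                    ≈⟨ root (suc i) ⟩
        0#                                          ∎
    ... | inj₁ d≈0 = contradiction (ρ-inj (x∙y⁻¹≈ε⇒x≈y _ _ d≈0)) λ ()
    ... | inj₂ Q≈0 = Q≈0

-- Field quotients by annihilators

annihilatorQuotient : (R : CommutativeRing c ℓ) → CommutativeRing.Carrier R → CommutativeRing c ℓ
annihilatorQuotient R e = record
  { Carrier = Carrier
  -- Only equality is coarsened, to equality modulo the annihilator of `e`; the quotient map is the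
  -- identity on carriers.
  ; _≈_ = λ x y → e * x ≈ e * y
  ; _+_ = _+_
  ; _*_ = _*_
  ; -_  = -_
  ; 0#  = 0#
  ; 1#  = 1#
  ; isCommutativeRing = record
    { isRing = record
      { +-isAbelianGroup = record
        { isGroup = record
          { isMonoid = record
            { isSemigroup = record
              { isMagma = record
                { isEquivalence = record { refl = refl ; sym = sym ; trans = trans }
                ; ∙-cong = λ p q → trans (distribˡ e _ _) (trans (+-cong p q) (sym (distribˡ e _ _)))
                }
              ; assoc = λ x y z → *-congˡ (+-assoc x y z)
              }
            ; identity = (λ x → *-congˡ (+-identityˡ x)) , (λ x → *-congˡ (+-identityʳ x))
            }
          ; inverse = (λ x → *-congˡ (-‿inverseˡ x)) , (λ x → *-congˡ (-‿inverseʳ x))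
          ; ⁻¹-cong = λ p → trans (sym (-‿distribʳ-* e _)) (trans (-‿cong p) (-‿distribʳ-* e _))
          }
        ; comm = λ x y → *-congˡ (+-comm x y)
        }
      ; *-cong = λ {x} {x′} {y} {y′} p q → begin
          e * (x * y)     ≈⟨ *-assoc e x y ⟨
          e * x * y       ≈⟨ *-congʳ p ⟩
          e * x′ * y      ≈⟨ x∙yz≈xy∙z′ e x′ y ⟩
          x′ * (e * y)    ≈⟨ *-congˡ q ⟩
          x′ * (e * y′)   ≈⟨ x∙yz≈xy∙z′ e x′ y′ ⟨
          e * x′ * y′     ≈⟨ *-assoc e x′ y′ ⟩
          e * (x′ * y′)   ∎
      ; *-assoc = λ x y z → *-congˡ (*-assoc x y z)
      ; *-identity = (λ x → *-congˡ (*-identityˡ x)) , (λ x → *-congˡ (*-identityʳ x))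
      ; distrib = (λ x y z → *-congˡ (distribˡ x y z)) , (λ x y z → *-congˡ (distribʳ x y z))
      }
    ; *-comm = λ x y → *-congˡ (*-comm x y)
    }
  }
  where
  open CommutativeRing R hiding (zero)
  open Algebra.Properties.Ring ring using (-‿distribʳ-*)
  open SetoidReasoning setoid
  x∙yz≈xy∙z′ : ∀ x y z → x * y * z ≈ y * (x * z)
  x∙yz≈xy∙z′ x y z = trans (*-congʳ (*-comm x y)) (*-assoc y x z)

FixedByPower : CommutativeRing c ℓ → ℕ → Set (c ⊔ ℓ)
FixedByPower R n = ∀ y → y ^ n ≈ y
  where
  open CommutativeRing R
  open Algebra.Properties.Semiring.Exp semiring

-- In a ring with y ^ (2 + t) ≈ y, a nonzero multiple e of u is refined, one
-- y at a time, until y is either zero or invertible modulo the annihilator of e.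
module Refinement (R : CommutativeRing c ℓ) (_≟_ : Decidable₂ (CommutativeRing._≈_ R))
         (t : ℕ) (fixed : FixedByPower R (2 ℕ.+ t)) where
  open CommutativeRing R hiding (zero)
  open Algebra.Properties.Semiring.Exp semiring
  open Algebra.Properties.Group +-group using (x∙y⁻¹≈ε⇒x≈y)
  open Algebra.Properties.Ring ring using (-‿distribˡ-*; -‿distribʳ-*)
  open SetoidReasoning setoid

  -- In `annihilatorQuotient R e` the two cases say that `y` is zero, or that it is a unit with
  -- inverse `y ^ t`.
  ZeroOrUnit : Carrier → Carrier → Set _
  ZeroOrUnit e y = e * y ≈ 0# ⊎ e * y ^ suc t ≈ e

  private
    multiple-*-≈ : ∀ {e e′ z y w} → e′ ≈ e * z → e * y ≈ w → e′ * y ≈ w * z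
    multiple-*-≈ {e} {e′} {z} {y} {w} e′≈ez ey≈w = begin
      e′ * y        ≈⟨ *-congʳ (trans e′≈ez (*-comm e z)) ⟩
      z * e * y     ≈⟨ *-assoc z e y ⟩
      z * (e * y)   ≈⟨ *-comm z _ ⟩
      e * y * z     ≈⟨ *-congʳ ey≈w ⟩
      w * z         ∎

  -- Verdicts persist under passing to multiples of `e`, so elements treated earlier stay settled.
  zeroOrUnit-multiple : ∀ {e e′ z y} → e′ ≈ e * z → ZeroOrUnit e y → ZeroOrUnit e′ y
  zeroOrUnit-multiple {z = z} e′≈ez (inj₁ ey≈0)  = inj₁ (trans (multiple-*-≈ e′≈ez ey≈0) (zeroˡ z))
  zeroOrUnit-multiple {z = z} e′≈ez (inj₂ eyᵗ≈e) = inj₂ (trans (multiple-*-≈ e′≈ez eyᵗ≈e) (sym e′≈ez))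

  -- Since `y ^ (2 + t) ≈ y`, the factor `1 - y ^ (1 + t)` kills `y`. If it also kills `e`, then `y`
  -- is a unit; otherwise its product with `e` is the new element, for which `y` is zero.
  refine : ∀ y e → ¬ e ≈ 0# → ∃[ e′ ] (¬ e′ ≈ 0# × (∃[ z ] e′ ≈ e * z) × ZeroOrUnit e′ y)
  refine y e e≉0 with (e * (1# + - (y ^ suc t))) ≟ 0#
  ... | yes eq = e , e≉0 , (1# , sym (*-identityʳ e)) , inj₂ (sym (x∙y⁻¹≈ε⇒x≈y _ _ (begin
    e + - (e * y ^ suc t)         ≈⟨ +-cong (sym (*-identityʳ e)) (-‿distribʳ-* e _) ⟩
    e * 1# + e * - (y ^ suc t)    ≈⟨ distribˡ e _ _ ⟨
    e * (1# + - (y ^ suc t))      ≈⟨ eq ⟩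
    0#                            ∎)))
  ... | no e′≉0 = e * (1# + - (y ^ suc t)) , e′≉0 , (_ , refl) , inj₁ (begin
    e * (1# + - (y ^ suc t)) * y       ≈⟨ *-assoc e _ y ⟩
    e * ((1# + - (y ^ suc t)) * y)     ≈⟨ *-congˡ (distribʳ y 1# _) ⟩
    e * (1# * y + - (y ^ suc t) * y)   ≈⟨ *-congˡ (+-cong (*-identityˡ y) (sym (-‿distribˡ-* _ y))) ⟩
    e * (y + - (y ^ suc t * y))        ≈⟨ *-congˡ (+-congˡ (-‿cong (trans (*-comm _ y) (fixed y)))) ⟩
    e * (y + - y)                      ≈⟨ trans (*-congˡ (-‿inverseʳ y)) (zeroʳ e) ⟩
    0#                                 ∎)

  refineAll : ∀ {n} (ys : Vector Carrier n) e → ¬ e ≈ 0# →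
              ∃[ e′ ] (¬ e′ ≈ 0# × (∃[ z ] e′ ≈ e * z) × ∀ i → ZeroOrUnit e′ (ys i))
  refineAll {zero}  ys e e≉0 = e , e≉0 , (1# , sym (*-identityʳ e)) , λ ()
  refineAll {suc n} ys e e≉0 with refine (ys zero) e e≉0
  ... | e₁ , e₁≉0 , (z₁ , e₁≈) , good₀ with refineAll (ys ∘ suc) e₁ e₁≉0
  ...   | e₂ , e₂≉0 , (z₂ , e₂≈) , good =
    e₂ , e₂≉0 , (z₁ * z₂ , trans e₂≈ (trans (*-congʳ e₁≈) (*-assoc e z₁ z₂))) ,
    λ { zero → zeroOrUnit-multiple e₂≈ good₀ ; (suc i) → good i }

  fieldQuotient : ∀ {n} (ys : Vector Carrier n) → (∀ y → ∃[ i ] ys i ≈ y) → ∀ u → ¬ u ≈ 0# →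
                  ∃[ e ] (¬ e ≈ 0# × ¬ e * u ≈ 0# × ∀ y → ZeroOrUnit e y)
  fieldQuotient ys covers u u≉0 with refineAll ys u u≉0
  ... | e , e≉0 , (z , e≈uz) , good = e , e≉0 , eu≉0 , good′
    where
    -- As `e` is a multiple of `u`, `e * u ≈ 0#` would give `e * e ≈ 0#`, and then `e ≈ e ^ (2 + t)`
    -- would be zero.
    eu≉0 : ¬ e * u ≈ 0#
    eu≉0 eu≈0 = e≉0 (begin
      e                   ≈⟨ fixed e ⟨
      e * (e * e ^ t)     ≈⟨ *-assoc e e _ ⟨
      e * e * e ^ t       ≈⟨ *-congʳ (trans (*-congˡ e≈uz) (sym (*-assoc e u z))) ⟩
      e * u * z * e ^ t   ≈⟨ *-congʳ (trans (*-congʳ eu≈0) (zeroˡ z)) ⟩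
      0# * e ^ t          ≈⟨ zeroˡ _ ⟩
      0#                  ∎)
    good′ : ∀ y → ZeroOrUnit e y
    good′ y with covers y
    ... | i , yᵢ≈y with good i
    ...   | inj₁ p = inj₁ (trans (*-congˡ (sym yᵢ≈y)) p)
    ...   | inj₂ p = inj₂ (trans (*-congˡ (^-congˡ (suc t) (sym yᵢ≈y))) p)

-- Restriction of scalars along a homomorphism

module SemiringHomomorphism {A : CommutativeRing c ℓ} {B : CommutativeRing c′ ℓ′}
         (ι : CommutativeRing.Carrier A → CommutativeRing.Carrier B)
         (hom : SemiringMorphisms.IsSemiringHomomorphism
                  (Semiring.rawSemiring (CommutativeRing.semiring A))
                  (Semiring.rawSemiring (CommutativeRing.semiring B)) ι) where
  private
    module A = CommutativeRing A
    module B = CommutativeRing B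
    module A^ = Algebra.Properties.Semiring.Exp A.semiring
    module B^ = Algebra.Properties.Semiring.Exp B.semiring
    module A· = Algebra.Properties.Semiring.Mult A.semiring
    module B· = Algebra.Properties.Semiring.Mult B.semiring
  open SemiringMorphisms.IsSemiringHomomorphism hom
    renaming (⟦⟧-cong to ι-cong) public

  ι-^ : ∀ a n → ι (a A^.^ n) B.≈ ι a B^.^ n
  ι-^ a zero    = 1#-homo
  ι-^ a (suc n) = B.trans (*-homo a _) (B.*-congˡ (ι-^ a n))

  ι-· : ∀ n a → ι (n A·.× a) B.≈ n B·.× ι a
  ι-· zero    a = 0#-homo
  ι-· (suc n) a = B.trans (+-homo a _) (B.+-congˡ (ι-· n a))

  restriction : LeftSemimodule A.semiring c′ ℓ′
  restriction = record
    { Carrierᴹ = B.Carrier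
    ; _≈ᴹ_     = B._≈_
    ; _+ᴹ_     = B._+_
    ; _*ₗ_     = λ a y → ι a B.* y
    ; 0ᴹ       = B.0#
    ; isLeftSemimodule = record
      { +ᴹ-isCommutativeMonoid = B.+-isCommutativeMonoid
      ; isPreleftSemimodule = record
        { *ₗ-cong      = λ a≈b x≈y → B.*-cong (ι-cong a≈b) x≈y
        ; *ₗ-zeroˡ     = λ y → B.trans (B.*-congʳ 0#-homo) (B.zeroˡ y)
        ; *ₗ-distribʳ  = λ y a b → B.trans (B.*-congʳ (+-homo a b)) (B.distribʳ y _ _)
        ; *ₗ-identityˡ = λ y → B.trans (B.*-congʳ 1#-homo) (B.*-identityˡ y)
        ; *ₗ-assoc     = λ a b y → B.trans (B.*-congʳ (*-homo a b)) (B.*-assoc _ _ y)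
        ; *ₗ-zeroʳ     = λ a → B.zeroʳ _
        ; *ₗ-distribˡ  = λ a → B.distribˡ (ι a)
        }
      }
    }

-- Field extensions of given degree

module _ {R : CommutativeRing c ℓ} {M : LeftSemimodule (CommutativeRing.semiring R) m ℓm} where
  open CommutativeRing R hiding (zero)
  open LeftSemimodule M
  open LinearCombination R M
  open Algebra.Properties.Ring ring using (-1*x≈-x)
  open Algebra.Properties.Group +-group using (x∙y⁻¹≈ε⇒x≈y)
  open SetoidReasoning ≈ᴹ-setoid

  independent⇒injective : ∀ {b : Vector Carrierᴹ n} → Independent b →
                          ∀ {a a′} → lc a b ≈ᴹ lc a′ b → ∀ i → a i ≈ a′ i
  independent⇒injective {b = b} ind {a} {a′} eq i =
    x∙y⁻¹≈ε⇒x≈y _ _ (trans (+-congˡ (sym (-1*x≈-x (a′ i)))) (ind _ (begin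
      lc (λ j → a j + - 1# * a′ j) b           ≈⟨ lc-+ a _ b ⟩
      lc a b +ᴹ lc (λ j → - 1# * a′ j) b       ≈⟨ +ᴹ-cong eq (lc-* (- 1#) a′ b) ⟩
      lc a′ b +ᴹ - 1# *ₗ lc a′ b               ≈⟨ +ᴹ-congʳ (*ₗ-identityˡ _) ⟨
      1# *ₗ lc a′ b +ᴹ - 1# *ₗ lc a′ b         ≈⟨ *ₗ-distribʳ _ 1# (- 1#) ⟨
      (1# + - 1#) *ₗ lc a′ b                   ≈⟨ *ₗ-congʳ (-‿inverseʳ 1#) ⟩
      0# *ₗ lc a′ b                            ≈⟨ *ₗ-zeroˡ _ ⟩
      0ᴹ ∎) i))

  -- The span witnesses serve as coordinates, unique by independence. This is how the order of `K`
  -- is read off from its dimension.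
  basisEnum : ∀ {q} → IsFiniteField R q → (b : Vector Carrierᴹ n) → Independent b → (∀ y → Span b y) →
              Inverse ≈ᴹ-setoid (≡.setoid (Fin (q ℕ.^ n)))
  basisEnum {n} isField b ind spans = record
    { to        = λ y → to (proj₁ (spans y))
    ; from      = λ i → lc (from i) b
    ; to-cong   = λ {y} {z} y≈z → to-cong (independent⇒injective ind
        (≈ᴹ-trans (proj₂ (spans y)) (≈ᴹ-trans y≈z (≈ᴹ-sym (proj₂ (spans z))))))
    ; from-cong = λ { ≡.refl → ≈ᴹ-refl }
    ; inverse   =
        (λ {i} {y} y≈ → ≡.trans
          (to-cong (independent⇒injective ind (≈ᴹ-trans (proj₂ (spans y)) y≈)))
          (strictlyInverseˡ i)) ,
        (λ { {y} ≡.refl → ≈ᴹ-trans (lc-congˡ b (strictlyInverseʳ (proj₁ (spans y)))) (proj₂ (spans y)) })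
    }
    where
    open IsFiniteField isField
    open Inverse (vectorEnum enumeration n)

-- σ maps 0 ↦ 1 ↦ … ↦ 1 + t ↦ 1, so that X ^ (2 + t) = X in its shift algebra.
module Rotation (t : ℕ) where

  σ : Fin (2 ℕ.+ t) → Fin (2 ℕ.+ t)
  σ i = suc (toℕ i mod suc t)

  -- After one step the orbit stays in the cycle `1, …, 1 + t`, on which `σ` adds one modulo
  -- `1 + t`, with the residues shifted by one.
  toℕ-iterate-σ : ∀ j i → toℕ (iterate σ i (suc j)) ≡ suc ((toℕ i ℕ.+ j) % suc t)
  toℕ-iterate-σ zero    i = ≡.cong suc (≡.trans (Fin.toℕ-fromℕ< (m%n<n (toℕ i) (suc t)))
    (≡.cong (_% suc t) (≡.sym (ℕ.+-identityʳ (toℕ i)))))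
  toℕ-iterate-σ (suc j) i = ≡.trans (toℕ-iterate-σ j (σ i)) (≡.cong suc (begin
    (suc (toℕ (toℕ i mod suc t)) ℕ.+ j) % suc t
      ≡⟨ ≡.cong (λ a → (suc a ℕ.+ j) % suc t) (Fin.toℕ-fromℕ< (m%n<n (toℕ i) (suc t))) ⟩
    (suc (toℕ i % suc t) ℕ.+ j) % suc t
      ≡⟨ ≡.cong (_% suc t) (≡.sym (ℕ.+-suc (toℕ i % suc t) j)) ⟩
    (toℕ i % suc t ℕ.+ suc j) % suc t
      ≡⟨ %-distribˡ-+ (toℕ i % suc t) (suc j) (suc t) ⟩
    (toℕ i % suc t % suc t ℕ.+ suc j % suc t) % suc t
      ≡⟨ ≡.cong (λ a → (a ℕ.+ suc j % suc t) % suc t) (m%n%n≡m%n (toℕ i) (suc t)) ⟩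
    (toℕ i % suc t ℕ.+ suc j % suc t) % suc t
      ≡⟨ %-distribˡ-+ (toℕ i) (suc j) (suc t) ⟨
    (toℕ i ℕ.+ suc j) % suc t ∎))
    where open ≡.≡-Reasoning

  iterate-σ-period : ∀ i → iterate σ i (2 ℕ.+ t) ≡ iterate σ i 1
  iterate-σ-period i = Fin.toℕ-injective (≡.trans (toℕ-iterate-σ (suc t) i)
    (≡.trans (≡.cong suc (≡.trans ([m+n]%n≡m%n (toℕ i) (suc t)) (≡.cong (_% suc t) (≡.sym (ℕ.+-identityʳ (toℕ i))))))
      (≡.sym (toℕ-iterate-σ 0 i))))

  toℕ-iterate-σ-zero : ∀ j → j ℕ.< 2 ℕ.+ t → toℕ (iterate σ zero j) ≡ j
  toℕ-iterate-σ-zero zero    _         = ≡.refl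
  toℕ-iterate-σ-zero (suc j) (s≤s j<M) = ≡.trans (toℕ-iterate-σ j zero) (≡.cong suc (m<n⇒m%n≡m j<M))

  iterate-σ-distinct : ∀ d → d ℕ.< 2 ℕ.+ t → ∀ j → j ℕ.< d → iterate σ zero j ≢ iterate σ zero d
  iterate-σ-distinct d d<N j j<d eq = ℕ.<⇒≢ j<d (≡.trans
    (≡.sym (toℕ-iterate-σ-zero j (ℕ.<-trans j<d d<N)))
    (≡.trans (≡.cong toℕ eq) (toℕ-iterate-σ-zero d d<N)))

record Extension (F : CommutativeRing c ℓ) (q h : ℕ) : Set (Level.suc (c ⊔ ℓ)) where
  field
    K           : CommutativeRing c (c ⊔ ℓ)
    isFieldK    : IsFiniteField K (q ℕ.^ h)
    ι           : CommutativeRing.Carrier F → CommutativeRing.Carrier K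
    hom         : SemiringMorphisms.IsSemiringHomomorphism
                    (Semiring.rawSemiring (CommutativeRing.semiring F))
                    (Semiring.rawSemiring (CommutativeRing.semiring K)) ι
    basis       : Vector (CommutativeRing.Carrier K) h
  open SemiringHomomorphism {A = F} {B = K} ι hom public
  open LinearCombination F restriction public
  field
    independent : Independent basis
    spanning    : ∀ y → Span basis y

-- The factor with exponent `q ^ d` vanishes in a field of `q ^ d` elements, so a nonzero product
-- excludes the degrees `1, …, n`.
frobeniusProduct : (R : CommutativeRing c ℓ) → CommutativeRing.Carrier R → ℕ → ℕ → CommutativeRing.Carrier R
frobeniusProduct R X q zero    = CommutativeRing.1# R
frobeniusProduct R X q (suc n) = frobeniusProduct R X q n * (X ^ (q ℕ.^ suc n) + - X)
  where
  open CommutativeRing R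
  open Algebra.Properties.Semiring.Exp semiring

-- The induction principle `generated` says that X generates R as an F-algebra.
record CyclicAlgebra (F : CommutativeRing c ℓ) (N : ℕ) : Set (Level.suc (c ⊔ ℓ)) where
  field
    R              : CommutativeRing c (c ⊔ ℓ)
    ι              : CommutativeRing.Carrier F → CommutativeRing.Carrier R
    ι-homomorphism : SemiringMorphisms.IsSemiringHomomorphism
                       (Semiring.rawSemiring (CommutativeRing.semiring F))
                       (Semiring.rawSemiring (CommutativeRing.semiring R)) ι
    X              : CommutativeRing.Carrier R
  open CommutativeRing R
  open Algebra.Properties.Semiring.Exp semiring
  field
    _≈?_           : Decidable₂ _≈_
    generated      : (P : Carrier → Set (c ⊔ ℓ)) → P Respects _≈_ → P 0# →
                     (∀ a f → P f → P (ι a + X * f)) → ∀ f → P f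
    X^N≈X          : X ^ N ≈ X

-- `N` is a variable tied to two expressions by equations: `q ^ h` serves Frobenius and Fermat,
-- while `2 + t` is the form needed by `Refinement`.
module _ {F : CommutativeRing c ℓ} {q} (isField : IsFiniteField F q) {p k} (pr : Prime p) (q≡p^k : q ≡ p ℕ.^ k)
         (h′ t N : ℕ) (N≡ : q ℕ.^ suc h′ ≡ N) (N≡2+t : N ≡ 2 ℕ.+ t) (A : CyclicAlgebra F N)
         (product≉0 : ¬ CommutativeRing._≈_ (CyclicAlgebra.R A)
                          (frobeniusProduct (CyclicAlgebra.R A) (CyclicAlgebra.X A) q h′)
                          (CommutativeRing.0# (CyclicAlgebra.R A))) where

  private
    h : ℕ
    h = suc h′

    open CyclicAlgebra A
    module F = CommutativeRing F
    module FF = FiniteField isField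
    module R = CommutativeRing R
    open Algebra.Properties.Semiring.Exp R.semiring
    module Rι = SemiringHomomorphism {A = F} {B = R} ι ι-homomorphism
    module RSpan = LinearCombination F Rι.restriction
    open Frobenius R using (frobenius-iterate)

    N≡p^ : N ≡ p ℕ.^ (k ℕ.* h)
    N≡p^ = ≡.trans (≡.sym N≡) (≡.trans (≡.cong (ℕ._^ h) q≡p^k) (ℕ.^-*-assoc p k h))

    -- `N` is a power of `p`, and `p · 1` vanishes in `R` because it does in `F`.
    additive-N : ∀ f g → (f R.+ g) ^ N R.≈ f ^ N R.+ g ^ N
    additive-N = ≡.subst (λ n → ∀ f g → (f R.+ g) ^ n R.≈ f ^ n R.+ g ^ n) (≡.sym N≡p^)
      (frobenius-iterate pr p·1≈0 (k ℕ.* h))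
      where
      open Algebra.Properties.Semiring.Mult R.semiring renaming (_×_ to infixr 8 _·_)
      p·1≈0 : p · R.1# R.≈ R.0#
      p·1≈0 = R.trans (×-congʳ p (R.sym Rι.1#-homo)) (R.trans (R.sym (Rι.ι-· p F.1#))
        (R.trans (Rι.ι-cong (FF.characteristic {p} {k} q≡p^k)) Rι.0#-homo))

    -- Induction over the generation of `R`: the `N`-th power map is additive and multiplicative,
    -- fixes scalars by Fermat, and fixes `X`.
    fixed : ∀ f → f ^ N R.≈ f
    fixed = generated (λ f → f ^ N R.≈ f)
      (λ f≈g eq → R.trans (^-congˡ N (R.sym f≈g)) (R.trans eq f≈g))
      (zeroᴺ N≡2+t)
      (λ a f eq → begin
        (ι a R.+ X R.* f) ^ N              ≈⟨ additive-N (ι a) (X R.* f) ⟩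
        ι a ^ N R.+ (X R.* f) ^ N          ≈⟨ R.+-cong (R.sym (Rι.ι-^ a N)) (^-distrib-* X f N) ⟩
        ι (a F^.^ N) R.+ X ^ N R.* f ^ N   ≈⟨ R.+-cong (Rι.ι-cong (a^N≈a a)) (R.*-cong X^N≈X eq) ⟩
        ι a R.+ X R.* f                    ∎)
      where
      open SetoidReasoning R.setoid
      open Algebra.Properties.CommutativeSemiring.Exp R.commutativeSemiring using (^-distrib-*)
      module F^ = Algebra.Properties.Semiring.Exp F.semiring
      a^N≈a : ∀ a → a F^.^ N F.≈ a
      a^N≈a a = F.trans (F^.^-congʳ a (≡.sym N≡)) (FF.fermat-iterate h a)
      zeroᴺ : ∀ {n} → n ≡ 2 ℕ.+ t → R.0# ^ n R.≈ R.0#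
      zeroᴺ ≡.refl = R.zeroˡ _

    powers : Vector R.Carrier N
    powers i = X ^ toℕ i

    1<N : 1 ℕ.< N
    1<N = ℕ.<-≤-trans (s≤s (s≤s z≤n)) (ℕ.≤-reflexive (≡.sym N≡2+t))

    -- The exponent `N` is included, where `X ^ N` wraps around to `X`; this is the case that makes
    -- the span closed under multiplication by `X`.
    power∈span : ∀ j → j ℕ.≤ N → RSpan.Span powers (X ^ j)
    power∈span j j≤N with j ℕ.<? N
    ... | yes j<N = RSpan.span-resp {v = powers} (^-congʳ X (Fin.toℕ-fromℕ< j<N))
        (RSpan.span-member powers (fromℕ< j<N))
    ... | no  j≮N with ≡.refl ← ℕ.≤-antisym j≤N (ℕ.≮⇒≥ j≮N) =
      RSpan.span-resp {v = powers}
        (R.trans (^-congʳ X (Fin.toℕ-fromℕ< 1<N)) (R.trans (R.*-identityʳ X) (R.sym X^N≈X)))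
        (RSpan.span-member powers (fromℕ< 1<N))

    X*-span : ∀ {f} → RSpan.Span powers f → RSpan.Span powers (X R.* f)
    X*-span (a , eq) = RSpan.span-resp {v = powers} (R.*-congˡ eq)
      (RSpan.lc-closed (λ g → RSpan.Span powers (X R.* g))
        (RSpan.span-resp {v = powers} (R.sym (R.zeroʳ X)) (RSpan.span-0 {v = powers}))
        (λ {f} {g} p q → RSpan.span-resp {v = powers} (R.sym (R.distribˡ X f g)) (RSpan.span-+ {v = powers} p q))
        (λ x {f} p → RSpan.span-resp {v = powers} (x∙yz≈y∙xz (ι x) X f) (RSpan.span-* {v = powers} x p))
        a powers
        (λ i → power∈span (suc (toℕ i)) (Fin.toℕ<n i)))
      where open Algebra.Properties.CommutativeSemigroup R.*-commutativeSemigroup using (x∙yz≈y∙xz)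

    powers-span : ∀ f → RSpan.Span powers f
    powers-span = generated (RSpan.Span powers) (RSpan.span-resp {v = powers}) (RSpan.span-0 {v = powers})
      (λ a f f∈ → RSpan.span-+ {v = powers}
        (RSpan.span-resp {v = powers} (R.*-identityʳ (ι a)) (RSpan.span-* {v = powers} a (power∈span 0 z≤n)))
        (X*-span f∈))

    elements : Σ[ fs ∈ Vector R.Carrier (q ℕ.^ N) ] (∀ {f} → RSpan.Span powers f → ∃[ i ] fs i R.≈ f)
    elements = RSpan.enumerateSpan isField _≈?_ powers

    open Refinement R _≈?_ t (λ y → R.trans (^-congʳ y (≡.sym N≡2+t)) (fixed y))
    u = frobeniusProduct R X q

    abstract
      quotientData : ∃[ e ] (¬ e R.≈ R.0# × ¬ e R.* u h′ R.≈ R.0# × ∀ y → ZeroOrUnit e y)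
      quotientData = fieldQuotient (proj₁ elements) (λ f → proj₂ elements (powers-span f)) (u h′) product≉0

    e : R.Carrier
    e = proj₁ quotientData

    K : CommutativeRing c (c ⊔ ℓ)
    K = annihilatorQuotient R e
    module K = CommutativeRing K

    ≈K-dec : Decidable₂ K._≈_
    ≈K-dec f g = (e R.* f) ≈? (e R.* g)

    1≉0 : ¬ K.1# K.≈ K.0#
    1≉0 eq = proj₁ (proj₂ quotientData)
      (R.trans (R.sym (R.*-identityʳ e)) (R.trans eq (R.zeroʳ e)))

    u≉0′ : ¬ u h′ K.≈ K.0#
    u≉0′ eq = proj₁ (proj₂ (proj₂ quotientData)) (R.trans eq (R.zeroʳ e))

    zeroOrUnit : ∀ y → y K.≈ K.0# ⊎ ∃[ z ] y K.* z K.≈ K.1#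
    zeroOrUnit y with proj₂ (proj₂ (proj₂ quotientData)) y
    ... | inj₁ ey≈0  = inj₁ (R.trans ey≈0 (R.sym (R.zeroʳ e)))
    ... | inj₂ eyᵗ≈e = inj₂ (y ^ t , R.trans eyᵗ≈e (R.sym (R.*-identityʳ e)))

    K-hom : SemiringMorphisms.IsSemiringHomomorphism
              (Semiring.rawSemiring F.semiring) (Semiring.rawSemiring K.semiring) ι
    K-hom = record
      { isNearSemiringHomomorphism = record
        { +-isMonoidHomomorphism = record
          { isMagmaHomomorphism = record
            { isRelHomomorphism = record { cong = λ a≈b → R.*-congˡ (Rι.ι-cong a≈b) }
            ; homo = λ a b → R.*-congˡ (Rι.+-homo a b)
            }
          ; ε-homo = R.*-congˡ Rι.0#-homo
          }
        ; *-homo = λ a b → R.*-congˡ (Rι.*-homo a b)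
        }
      ; 1#-homo = R.*-congˡ Rι.1#-homo
      }

    module Kι = SemiringHomomorphism {A = F} {B = K} ι K-hom
    module KSpan = LinearCombination F Kι.restriction

    abstract
      K-basis : ∃[ d ] (d ℕ.≤ N × Σ[ b ∈ Vector K.Carrier d ]
                  (KSpan.Independent b × (∀ i → KSpan.Span b (powers i)) × (∀ i → KSpan.Span powers (b i))))
      K-basis = KSpan.extractBasis isField ≈K-dec powers

    d : ℕ
    d = proj₁ K-basis

    b : Vector K.Carrier d
    b = proj₁ (proj₂ (proj₂ K-basis))

    b-independent : KSpan.Independent b
    b-independent = proj₁ (proj₂ (proj₂ (proj₂ K-basis)))

    b-spanning : ∀ y → KSpan.Span b y
    b-spanning y with powers-span y
    ... | a , eq = KSpan.span-trans {w = powers} (proj₁ (proj₂ (proj₂ (proj₂ (proj₂ K-basis))))) (a , R.*-congˡ eq)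

    abstract
      isFieldK : IsFiniteField K (q ℕ.^ d)
      isFieldK = record
        { enumeration = basisEnum {R = F} {M = Kι.restriction} isField b b-independent b-spanning
        ; 1≉0         = 1≉0
        ; zeroOrUnit  = zeroOrUnit
        }

    module KF = FiniteField isFieldK
    module K^ = Algebra.Properties.Semiring.Exp K.semiring

    ^-agrees : ∀ y n → y K^.^ n ≡ y ^ n
    ^-agrees y zero    = ≡.refl
    ^-agrees y (suc n) = ≡.cong (y R.*_) (^-agrees y n)

    -- Fermat in K makes the factor X ^ qᵈ - X of u vanish.
    d≰h′ : ∀ n → 1 ℕ.≤ d → d ℕ.≤ n → u n K.≈ K.0#
    d≰h′ zero    1≤d d≤0 = contradiction (ℕ.≤-trans 1≤d d≤0) λ ()
    d≰h′ (suc n) 1≤d d≤n with ℕ.m≤n⇒m<n∨m≡n d≤n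
    ... | inj₁ (s≤s d≤n′) = K.trans (K.*-congʳ (d≰h′ n 1≤d d≤n′)) (K.zeroˡ _)
    ... | inj₂ d≡1+n = begin
      u n K.* (X ^ (q ℕ.^ suc n) K.+ K.- X)      ≡⟨ ≡.cong (λ m → u n K.* (X ^ (q ℕ.^ m) K.+ K.- X)) d≡1+n ⟨
      u n K.* (X ^ (q ℕ.^ d) K.+ K.- X)          ≡⟨ ≡.cong (λ y → u n K.* (y K.+ K.- X)) (^-agrees X (q ℕ.^ d)) ⟨
      u n K.* (X K^.^ (q ℕ.^ d) K.+ K.- X)       ≈⟨ K.*-congˡ (K.+-congʳ (KF.fermat X)) ⟩
      u n K.* (X K.+ K.- X)                      ≈⟨ K.*-congˡ (K.-‿inverseʳ X) ⟩
      u n K.* K.0#                               ≈⟨ K.zeroʳ (u n) ⟩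
      K.0#                                       ∎
      where open SetoidReasoning K.setoid

    -- In dimension zero every combination is empty, and `1#` would be zero in `K`.
    1≤d : 1 ℕ.≤ d
    1≤d = ℕ.n≢0⇒n>0 λ d≡0 → 1≉0 (K.trans (K.sym (proj₂ (b-spanning K.1#)))
      (empty d≡0 (proj₁ (b-spanning K.1#))))
      where
      empty : d ≡ 0 → ∀ a → KSpan.lc a b K.≈ K.0#
      empty d≡0 a = KSpan.lc-zero b (λ i → contradiction (≡.subst Fin d≡0 i) λ ())

    h≤d : h ℕ.≤ d
    h≤d = ℕ.≰⇒> λ d≤h′ → u≉0′ (d≰h′ h′ 1≤d d≤h′)

    open Polynomial isFieldK

    monomial : ℕ → List K.Carrier
    monomial zero    = K.1# ∷ []
    monomial (suc n) = K.0# ∷ monomial n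

    length-monomial : ∀ n → length (monomial n) ≡ suc n
    length-monomial zero    = ≡.refl
    length-monomial (suc n) = ≡.cong suc (length-monomial n)

    eval-monomial : ∀ n y → eval (monomial n) y K.≈ y K^.^ n
    eval-monomial zero    y = K.trans (K.+-congˡ (K.zeroʳ y)) (K.+-identityʳ K.1#)
    eval-monomial (suc n) y = K.trans (K.+-identityˡ _) (K.*-congˡ (eval-monomial n y))

    -- Tᴺ - T, which vanishes on all of K.
    g : List K.Carrier
    g = K.0# ∷ K.- K.1# ∷ monomial t

    eval-g : ∀ y → eval g y K.≈ K.0#
    eval-g y = begin
      K.0# K.+ y K.* (K.- K.1# K.+ y K.* eval (monomial t) y)
        ≈⟨ K.+-identityˡ _ ⟩
      y K.* (K.- K.1# K.+ y K.* eval (monomial t) y)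
        ≈⟨ K.*-congˡ (K.+-congˡ (K.*-congˡ (eval-monomial t y))) ⟩
      y K.* (K.- K.1# K.+ y K^.^ suc t)
        ≈⟨ K.distribˡ y _ _ ⟩
      y K.* K.- K.1# K.+ y K^.^ (2 ℕ.+ t)
        ≈⟨ K.+-cong
             (K.trans (K.sym (-‿distribʳ-* y K.1#)) (K.-‿cong (K.*-identityʳ y)))
             (K.trans (K.reflexive (^-agrees y (2 ℕ.+ t)))
               (R.*-congˡ (R.trans (^-congʳ y (≡.sym N≡2+t)) (fixed y)))) ⟩
      K.- y K.+ y
        ≈⟨ K.-‿inverseˡ y ⟩
      K.0# ∎
      where
      open SetoidReasoning K.setoid
      open Algebra.Properties.Ring K.ring using (-‿distribʳ-*)

    g≉0 : ¬ IsZero g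
    g≉0 (_ ∷ -1≈0 ∷ _) = 1≉0 (K.trans (K.sym (⁻¹-involutive K.1#)) (K.trans (K.-‿cong -1≈0) ε⁻¹≈ε))
      where open Algebra.Properties.Group K.+-group using (⁻¹-involutive; ε⁻¹≈ε)

    -- The nonzero `g` has `q ^ h + 1` coefficients and all `q ^ d` elements of `K` as roots, too
    -- many if `h < d`.
    d≤h : d ℕ.≤ h
    d≤h = ℕ.≮⇒≥ λ h<d → g≉0 (manyRoots⇒isZero g (|g|≤ h<d) from
      (λ {i} {j} eq → ≡.trans (≡.sym (strictlyInverseˡ i)) (≡.trans (to-cong eq) (strictlyInverseˡ j)))
      (λ i → eval-g (from i)))
      where
      open Inverse KF.enumeration
      |g|≤ : h ℕ.< d → length g ℕ.≤ q ℕ.^ d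
      |g|≤ h<d = ℕ.≤-trans
        (ℕ.≤-reflexive (≡.trans (≡.cong (2 ℕ.+_) (length-monomial t)) (≡.cong suc (≡.sym (≡.trans N≡ N≡2+t)))))
        (ℕ.^-monoʳ-< q FF.order>1 h<d)

  fieldQuotient-extension : Extension F q (suc h′)
  fieldQuotient-extension = ≡.subst (Extension F q) (ℕ.≤-antisym d≤h h≤d) (record
    { K           = K
    ; isFieldK    = isFieldK
    ; ι           = ι
    ; hom         = K-hom
    ; basis       = b
    ; independent = b-independent
    ; spanning    = b-spanning
    })

module _ {F : CommutativeRing c ℓ} {q} (isField : IsFiniteField F q) {p k} (pr : Prime p) (q≡p^k : q ≡ p ℕ.^ k)
         (h′ t : ℕ) (N≡ : q ℕ.^ suc h′ ≡ 2 ℕ.+ t) where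

  private
    open IsFiniteField isField using (order>1; 1≉0)
    open Rotation t
    open ShiftAlgebra F σ
    module R = CommutativeRing shiftAlgebra

    u : ℕ → R.Carrier
    u = frobeniusProduct shiftAlgebra X q

    degree : ℕ → ℕ
    degree zero    = 0
    degree (suc n) = degree n ℕ.+ q ℕ.^ suc n

    q^suc>1 : ∀ n → 1 ℕ.< q ℕ.^ suc n
    q^suc>1 n = ℕ.<-≤-trans order>1 (ℕ.m≤m*n q (q ℕ.^ n) {{ℕ.m^n≢0 q n {{q≢0}}}})
      where q≢0 = ℕ.>-nonZero (ℕ.<-trans (s≤s z≤n) order>1)

    -- The degree is `q + … + q ^ n`, and the induction needs only `2 * q ^ (1 + n) ≤ q ^ (2 + n)`.
    -- For `u h′` the degree stays below `N`, so the orbit points up to it are distinct.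
    degree< : ∀ n → degree n ℕ.< q ℕ.^ suc n
    degree< zero    = ℕ.<-trans (s≤s z≤n) (q^suc>1 0)
    degree< (suc n) = ℕ.<-≤-trans (ℕ.+-monoˡ-< (q ℕ.^ suc n) (degree< n))
      (ℕ.≤-trans (ℕ.≤-reflexive (≡.cong (q ℕ.^ suc n ℕ.+_) (≡.sym (ℕ.+-identityʳ (q ℕ.^ suc n)))))
        (ℕ.*-monoˡ-≤ (q ℕ.^ suc n) order>1))

    u-monic : ∀ n → Monic zero (degree n) (u n)
    u-monic zero    = monic-1 zero
    u-monic (suc n) = monic-* zero (degree n) (q ℕ.^ suc n) (u n) (q^suc>1 n) (u-monic n)

    u≉0 : ¬ u h′ R.≈ R.0#
    u≉0 = monic≉0 {f = u h′} 1≉0 (u-monic h′)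
      (iterate-σ-distinct (degree h′) (ℕ.<-≤-trans (degree< h′) (ℕ.≤-reflexive N≡)))

    generated : (P : R.Carrier → Set (c ⊔ ℓ)) → P Respects R._≈_ → P R.0# →
                (∀ a f → P f → P (ι a R.+ X R.* f)) → ∀ f → P f
    generated P resp P0 P∷ []      = P0
    generated P resp P0 P∷ (a ∷ f) =
      resp (R.sym {a ∷ f} {ι a R.+ X R.* f} (∷-expand a f)) (P∷ a f (generated P resp P0 P∷ f))

    algebra : CyclicAlgebra F (2 ℕ.+ t)
    algebra = record
      { R              = shiftAlgebra
      ; ι              = ι
      ; ι-homomorphism = ι-homomorphism
      ; X              = X
      ; _≈?_           = ≈ˡ-dec isField
      ; generated      = generated
      ; X^N≈X          = λ w i → trans (X^-cong (2 ℕ.+ t) 1 iterate-σ-period w i) (R.*-identityʳ X w i)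
      }
      where open CommutativeRing F using (trans)

  extension : Extension F q (suc h′)
  extension = fieldQuotient-extension isField {p} {k} pr q≡p^k h′ t (2 ℕ.+ t) N≡ ≡.refl algebra u≉0

-- The code

record LinearMap {S : Semiring c ℓ} (M : LeftSemimodule S m₁ ℓ₁) (N : LeftSemimodule S m₂ ℓ₂) :
                 Set (c ⊔ m₁ ⊔ ℓ₁ ⊔ m₂ ⊔ ℓ₂) where
  private
    module M = LeftSemimodule M
    module N = LeftSemimodule N
  field
    apply  : M.Carrierᴹ → N.Carrierᴹ
    cong   : ∀ {x y} → x M.≈ᴹ y → apply x N.≈ᴹ apply y
    +-homo : ∀ x y → apply (x M.+ᴹ y) N.≈ᴹ apply x N.+ᴹ apply y
    *-homo : ∀ a x → apply (a M.*ₗ x) N.≈ᴹ a N.*ₗ apply x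

open LinearMap using (apply)

module _ {S : Semiring c ℓ} {L : LeftSemimodule S m₁ ℓ₁} {M : LeftSemimodule S m₂ ℓ₂}
         {N : LeftSemimodule S m₃ ℓ₃} where
  private module N = LeftSemimodule N

  infixr 9 _∘ₗ_
  _∘ₗ_ : LinearMap M N → LinearMap L M → LinearMap L N
  f ∘ₗ g = record
    { apply  = F.apply ∘ G.apply
    ; cong   = F.cong ∘ G.cong
    ; +-homo = λ x y → N.≈ᴹ-trans (F.cong (G.+-homo x y)) (F.+-homo _ _)
    ; *-homo = λ a x → N.≈ᴹ-trans (F.cong (G.*-homo a x)) (F.*-homo a _)
    }
    where
    module F = LinearMap f
    module G = LinearMap g

module _ {R : CommutativeRing c ℓ} where
  open CommutativeRing R hiding (zero)

  module _ {M : LeftSemimodule semiring m₁ ℓ₁} {N : LeftSemimodule semiring m₂ ℓ₂}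
           (f : LinearMap M N) where
    private
      module M = LeftSemimodule M
      module N = LeftSemimodule N
      module LM = LinearCombination R M
      module LN = LinearCombination R N
    open LinearMap f renaming (apply to ⟦_⟧)

    0-homo : ⟦ M.0ᴹ ⟧ N.≈ᴹ N.0ᴹ
    0-homo = N.≈ᴹ-trans (cong (M.≈ᴹ-sym (M.*ₗ-zeroˡ M.0ᴹ))) (N.≈ᴹ-trans (*-homo 0# M.0ᴹ) (N.*ₗ-zeroˡ _))

    lc-homo : ∀ {n} (a : Vector Carrier n) v → ⟦ LM.lc a v ⟧ N.≈ᴹ LN.lc a (⟦_⟧ ∘ v)
    lc-homo {zero}  a v = 0-homo
    lc-homo {suc n} a v = N.≈ᴹ-trans (+-homo _ _)
      (N.+ᴹ-cong (*-homo (a zero) (v zero)) (lc-homo (a ∘ suc) (v ∘ suc)))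

  module _ {M : LeftSemimodule semiring m₁ ℓ₁} {b : Vector (LeftSemimodule.Carrierᴹ M) n}
           (ind : LinearCombination.Independent R M b)
           (spans : ∀ y → LinearCombination.Span R M b y) where
    open LeftSemimodule M
    open LinearCombination R M

    combinationMap : LinearMap (vectorSemimodule R n) M
    combinationMap = record
      { apply  = λ a → lc a b
      ; cong   = lc-congˡ b
      ; +-homo = λ a a′ → lc-+ a a′ b
      ; *-homo = λ x a → lc-* x a b
      }

    coordinates : LinearMap M (vectorSemimodule R n)
    coordinates = record
      { apply  = λ y → proj₁ (spans y)
      ; cong   = λ {y} {z} y≈z → injective (≈ᴹ-trans (proj₂ (spans y)) (≈ᴹ-trans y≈z (≈ᴹ-sym (proj₂ (spans z)))))
      ; +-homo = λ y z → injective (≈ᴹ-trans (proj₂ (spans (y +ᴹ z)))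
          (≈ᴹ-sym (≈ᴹ-trans (lc-+ _ _ b) (+ᴹ-cong (proj₂ (spans y)) (proj₂ (spans z))))))
      ; *-homo = λ x y → injective (≈ᴹ-trans (proj₂ (spans (x *ₗ y)))
          (≈ᴹ-sym (≈ᴹ-trans (lc-* x _ b) (*ₗ-congˡ (proj₂ (spans y))))))
      }
      where
      injective = independent⇒injective {R = R} {M = M} ind

    coordinates≈0 : ∀ {y} → (∀ i → apply coordinates y i ≈ 0#) → y ≈ᴹ 0ᴹ
    coordinates≈0 {y} eq = ≈ᴹ-trans (≈ᴹ-sym (proj₂ (spans y))) (lc-zero b eq)

  module _ where
    open Algebra.Properties.Semiring.Sum semiring
    open DotProduct R
    open SetoidReasoning setoid

    unit : Fin n → Vector Carrier n
    unit i j with i Fin.≟ j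
    ... | yes _ = 1#
    ... | no  _ = 0#

    unit-same : ∀ (i : Fin n) → unit i i ≈ 1#
    unit-same i with i Fin.≟ i
    ... | yes _  = refl
    ... | no i≢i = contradiction ≡.refl i≢i

    unit-other : ∀ {i j : Fin n} → i ≢ j → unit i j ≈ 0#
    unit-other {i = i} {j} i≢j with i Fin.≟ j
    ... | yes i≡j = contradiction i≡j i≢j
    ... | no  _   = refl

    sum-unit : ∀ (v : Vector Carrier n) j → sum (λ i → v i * unit i j) ≈ v j
    sum-unit {suc n} v j = begin
      sum t                                        ≈⟨ sum-remove {i = j} t ⟩
      v j * unit j j + sum (Vector.removeAt t j)   ≈⟨ +-cong (trans (*-congˡ (unit-same j)) (*-identityʳ _))
                                                      (trans (sum-cong-≋ off) (sum-replicate-zero n)) ⟩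
      v j + 0#                                     ≈⟨ +-identityʳ _ ⟩
      v j                                          ∎
      where
      t = λ i → v i * unit i j
      off : ∀ i → Vector.removeAt t j i ≈ 0#
      off i = trans (*-congˡ (unit-other (Fin.punchInᵢ≢i j i))) (zeroʳ _)

    module _ {r h} (f : LinearMap (vectorSemimodule R r) (vectorSemimodule R h)) where

      -- Stored by rows: row `l` represents the `l`-th coordinate of `f` through the dot product, so
      -- `f` vanishes at `φ` exactly when the rows are orthogonal to `φ`.
      matrix : Vector (Vector Carrier r) h
      matrix l j = apply f (unit j) l

      ∙-matrix : ∀ φ l → φ ∙ matrix l ≈ apply f φ l
      ∙-matrix φ l = begin
        φ ∙ matrix l                   ≈⟨ lc-pointwise φ (λ j → apply f (unit j)) l ⟨
        lc φ (λ j → apply f (unit j)) l ≈⟨ lc-homo f φ unit l ⟨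
        apply f (lc φ unit) l
          ≈⟨ LinearMap.cong f (λ j → trans (lc-pointwise φ unit j) (sum-unit φ j)) l ⟩
        apply f φ l                    ∎

    -- `nothing` stands for a coordinate that is constantly zero, used as padding.
    select : ∀ {r h} → (Fin h → Maybe (Fin r)) → LinearMap (vectorSemimodule R r) (vectorSemimodule R h)
    select ix = record
      { apply  = λ v l → at v (ix l)
      ; cong   = λ v≋w l → at-cong v≋w (ix l)
      ; +-homo = λ v w l → at-+ v w (ix l)
      ; *-homo = λ a v l → at-* a v (ix l)
      }
      where
      at : Vector Carrier n → Maybe (Fin n) → Carrier
      at v = maybe′ v 0#
      at-cong : ∀ {v w : Vector Carrier n} → (∀ i → v i ≈ w i) → ∀ i → at v i ≈ at w i
      at-cong v≋w (just i) = v≋w i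
      at-cong v≋w nothing  = refl
      at-+ : ∀ (v w : Vector Carrier n) i → at (λ j → v j + w j) i ≈ at v i + at w i
      at-+ v w (just i) = refl
      at-+ v w nothing  = sym (+-identityˡ 0#)
      at-* : ∀ a (v : Vector Carrier n) i → at (λ j → a * v j) i ≈ a * at v i
      at-* a v (just i) = refl
      at-* a v nothing  = sym (zeroʳ a)

module Code (R : CommutativeRing c ℓ) {q} (isField : IsFiniteField R q) where
  open CommutativeRing R hiding (zero)
  open IsFiniteField isField
  open DotProduct R using (_∙_)

  Orthogonal : ∀ {r h} → Vector (Vector Carrier r) h → Vector Carrier r → Set _
  Orthogonal g φ = ∀ l → φ ∙ g l ≈ 0#

  orthogonal? : ∀ {r h} (g : Vector (Vector Carrier r) h) → Decidable (Orthogonal g)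
  orthogonal? g φ = Fin.all? (λ l → (φ ∙ g l) ≟ 0#)

  IsNonzero : ∀ {r} → Vector Carrier r → Set _
  IsNonzero φ = ¬ (∀ j → φ j ≈ 0#)

  zeros : ∀ {n r h} → Vector (Vector (Vector Carrier r) h) n → Vector Carrier r → ℕ
  zeros g φ = count (λ i → orthogonal? (g i) φ)

  -- The row spaces of the g i form a system in which each hyperplane φ ⊥ contains at most s of them.
  IsCode : ∀ {n r h} → ℕ → Vector (Vector (Vector Carrier r) h) n → Set _
  IsCode s g = ∀ φ → IsNonzero φ → zeros g φ ℕ.≤ s

  -- Codewords are polynomials f of degree ≤ s over K whose leading coefficient lies in a k-dimensional
  -- subspace; β is the coefficient of degree s - 1. The coordinates are the values f (x), x ∈ K, and two
  -- halves of β, each together with the leading coefficient.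
  module _ (k t s′ : ℕ) (E : Extension R q (k ℕ.+ (k ℕ.+ t))) where
    private
      h s r : ℕ
      h = k ℕ.+ (k ℕ.+ t)
      s = suc s′
      r = h ℕ.* s ℕ.+ k
      open Extension E using (K; isFieldK; basis; independent; spanning; restriction)
      module K = CommutativeRing K
      module KF = IsFiniteField isFieldK
      open Polynomial isFieldK

      V : ∀ n → LeftSemimodule semiring c ℓ
      V = vectorSemimodule R

      KMap : Set _
      KMap = LinearMap (V r) restriction

      -- Block `zero` holds the coefficient of degree `s - 1`, block `suc j` the one of degree `j`;
      -- the last `k` positions of `r` hold the leading coefficient.
      block : Fin s → Fin h → Fin r
      block j l = combine l j ↑ˡ k

      leading : Fin k → Fin r
      leading i = h ℕ.* s ↑ʳ i

      combination : LinearMap (V h) restriction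
      combination = combinationMap {R = R} {M = restriction} independent spanning

      -- Zero padding confines the leading coefficient to the span of the first `k` basis elements
      -- of `K`.
      pad : Fin h → Maybe (Fin r)
      pad l = [ just ∘ leading , (λ _ → nothing) ]′ (splitAt k l)

      low : List KMap
      low = List.tabulate (λ j → combination ∘ₗ select {R = R} (just ∘ block (suc j)))

      β α : KMap
      β = combination ∘ₗ select {R = R} (just ∘ block zero)
      α = combination ∘ₗ select {R = R} pad

      values : List KMap → Vector Carrier r → List K.Carrier
      values cs φ = List.map (λ f → apply f φ) cs

      evaluation : List KMap → K.Carrier → KMap
      evaluation cs x = record
        { apply  = λ φ → eval (values cs φ) x
        ; cong   = λ φ≋ψ → eval-≋ cs φ≋ψ
        ; +-homo = eval-+ cs
        ; *-homo = eval-* cs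
        }
        where
        open SetoidReasoning K.setoid
        open Algebra.Properties.CommutativeSemigroup K.+-commutativeSemigroup using (interchange)
        open Algebra.Properties.CommutativeSemigroup K.*-commutativeSemigroup using (x∙yz≈y∙xz)
        open Extension E using (ι)
        eval-≋ : ∀ cs {φ ψ} → (∀ j → φ j ≈ ψ j) → eval (values cs φ) x K.≈ eval (values cs ψ) x
        eval-≋ []       φ≋ψ = K.refl
        eval-≋ (f ∷ cs) φ≋ψ = K.+-cong (LinearMap.cong f φ≋ψ) (K.*-congˡ (eval-≋ cs φ≋ψ))
        eval-+ : ∀ cs φ ψ → eval (values cs (λ j → φ j + ψ j)) x K.≈ eval (values cs φ) x K.+ eval (values cs ψ) x
        eval-+ []       φ ψ = K.sym (K.+-identityˡ K.0#)
        eval-+ (f ∷ cs) φ ψ = K.trans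
          (K.+-cong (LinearMap.+-homo f φ ψ) (K.trans (K.*-congˡ (eval-+ cs φ ψ)) (K.distribˡ x _ _)))
          (interchange _ _ _ _)
        eval-* : ∀ cs a φ → eval (values cs (λ j → a * φ j)) x K.≈ ι a K.* eval (values cs φ) x
        eval-* []       a φ = K.sym (K.zeroʳ (ι a))
        eval-* (f ∷ cs) a φ = K.trans
          (K.+-cong (LinearMap.*-homo f a φ) (K.trans (K.*-congˡ (eval-* cs a φ)) (x∙yz≈y∙xz x (ι a) _)))
          (K.sym (K.distribˡ (ι a) _ _))

      coords : LinearMap restriction (V h)
      coords = coordinates {R = R} {M = restriction} independent spanning

      -- `extra₁` has the `k` leading coordinates and the last `k + t` of `β`; `extra₂` has the
      -- first `k` of `β`, the `k` leading ones and `t` zeros.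
      extra₁ extra₂ : Fin h → Maybe (Fin r)
      extra₁ l = [ just ∘ leading , (λ i → just (block zero (k ↑ʳ i))) ]′ (splitAt k l)
      extra₂ l = [ (λ i → just (block zero (i ↑ˡ (k ℕ.+ t)))) ,
                   (λ i → [ just ∘ leading , (λ _ → nothing) ]′ (splitAt k i)) ]′ (splitAt k l)

      coefficients : List KMap
      coefficients = low ++ β ∷ α ∷ []

      coordinate : Vector (LinearMap (V r) (V h)) (2 ℕ.+ q ℕ.^ h)
      coordinate zero          = select {R = R} extra₁
      coordinate (suc zero)    = select {R = R} extra₂
      coordinate (suc (suc i)) = coords ∘ₗ evaluation coefficients (Inverse.from KF.enumeration i)

    generators : Vector (Vector (Vector Carrier r) h) (2 ℕ.+ q ℕ.^ h)
    generators i = matrix {R = R} (coordinate i)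

    private
      orthogonal⇒0 : ∀ i φ → Orthogonal (generators i) φ → ∀ l → apply (coordinate i) φ l ≈ 0#
      orthogonal⇒0 i φ ⊥ l = trans (sym (∙-matrix {R = R} (coordinate i) φ l)) (⊥ l)

      combination-injective : ∀ {v} → apply combination v K.≈ K.0# → ∀ l → v l ≈ 0#
      combination-injective {v} eq = independent v eq

      combination-0 : ∀ {v} → (∀ l → v l ≈ 0#) → apply combination v K.≈ K.0#
      combination-0 = Extension.lc-zero E basis

      module _ (φ : Vector Carrier r) where

        Leading₀ β₀ : Set _
        Leading₀ = ∀ i → φ (leading i) ≈ 0#
        β₀ = ∀ l → φ (block zero l) ≈ 0#

        pad⇒leading : (∀ l → apply (select {R = R} pad) φ l ≈ 0#) → Leading₀
        pad⇒leading eq i with eq (i ↑ˡ (k ℕ.+ t))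
        ... | eqᵢ rewrite Fin.splitAt-↑ˡ k i (k ℕ.+ t) = eqᵢ

        leading⇒pad : Leading₀ → ∀ l → apply (select {R = R} pad) φ l ≈ 0#
        leading⇒pad eq l with splitAt k l
        ... | inj₁ i = eq i
        ... | inj₂ _ = refl

        extra₁⇒leading : Orthogonal (generators zero) φ → Leading₀
        extra₁⇒leading ⊥ i with orthogonal⇒0 zero φ ⊥ (i ↑ˡ (k ℕ.+ t))
        ... | eqᵢ rewrite Fin.splitAt-↑ˡ k i (k ℕ.+ t) = eqᵢ

        extra₂⇒leading : Orthogonal (generators (suc zero)) φ → Leading₀
        extra₂⇒leading ⊥ i with orthogonal⇒0 (suc zero) φ ⊥ (k ↑ʳ (i ↑ˡ t))
        ... | eqᵢ rewrite Fin.splitAt-↑ʳ k (k ℕ.+ t) (i ↑ˡ t) | Fin.splitAt-↑ˡ k i t = eqᵢ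

        -- The first `k` coordinates of `β` are read from `extra₂`, the remaining ones from
        -- `extra₁`.
        extras⇒β : Orthogonal (generators zero) φ → Orthogonal (generators (suc zero)) φ → β₀
        extras⇒β ⊥₁ ⊥₂ l with splitAt k l in eq
        ... | inj₁ i with orthogonal⇒0 (suc zero) φ ⊥₂ l
        ...   | eqᵢ rewrite eq | Fin.splitAt⁻¹-↑ˡ eq = eqᵢ
        extras⇒β ⊥₁ ⊥₂ l | inj₂ i with orthogonal⇒0 zero φ ⊥₁ l
        ...   | eqᵢ rewrite eq | Fin.splitAt⁻¹-↑ʳ eq = eqᵢ

        low-β-leading⇒0 : IsZero (values low φ) → β₀ → Leading₀ → ∀ j → φ j ≈ 0#
        low-β-leading⇒0 low₀ β₀ leading₀ j with splitAt (h ℕ.* s) j in eq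
        ... | inj₂ i rewrite ≡.sym (Fin.splitAt⁻¹-↑ʳ eq) = leading₀ i
        ... | inj₁ i with Fin.combine-surjective {h} {s} i
        ...   | l , zero   , eq′ rewrite ≡.sym (Fin.splitAt⁻¹-↑ˡ eq) | ≡.sym eq′ = β₀ l
        ...   | l , suc j′ , eq′ rewrite ≡.sym (Fin.splitAt⁻¹-↑ˡ eq) | ≡.sym eq′ =
          combination-injective (All.tabulate⁻ (All.map⁻ low₀) j′) l

        eval-++ : ∀ cs {ds es x} → eval (values ds φ) x K.≈ eval (values es φ) x →
                  eval (values (cs ++ ds) φ) x K.≈ eval (values (cs ++ es) φ) x
        eval-++ []       eq = eq
        eval-++ (f ∷ cs) eq = K.+-congˡ (K.*-congˡ (eval-++ cs eq))

        rootCount : ℕ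
        rootCount = count (λ i → orthogonal? (generators (suc (suc i))) φ)

        rootCount< : ∀ cs → (∀ x → eval (values coefficients φ) x K.≈ eval (values cs φ) x) →
                     ¬ IsZero (values cs φ) → rootCount ℕ.< length cs
        rootCount< cs eq cs≉0 = ℕ.≰⇒> λ |cs|≤ → cs≉0
          (manyRoots⇒isZero (values cs φ) (ℕ.≤-trans (ℕ.≤-reflexive (List.length-map _ cs)) |cs|≤)
            (from ∘ f)
            (λ {i} {j} e → f-injective
              (≡.trans (≡.sym (strictlyInverseˡ (f i))) (≡.trans (to-cong e) (strictlyInverseˡ (f j)))))
            (λ i → K.trans (K.sym (eq (from (f i)))) (root (f i) (∈-satisfying⁻ orth? (f∈ i)))))
          where
          open Inverse KF.enumeration
          orth? = λ i → orthogonal? (generators (suc (suc i))) φ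
          roots = members (satisfying orth?)
          f = proj₁ roots
          f∈ = proj₁ (proj₂ roots)
          f-injective = proj₂ (proj₂ roots)
          root : ∀ i → Orthogonal (generators (suc (suc i))) φ → eval (values coefficients φ) (from i) K.≈ K.0#
          root i ⊥ = coordinates≈0 {R = R} {M = restriction} independent spanning (orthogonal⇒0 (suc (suc i)) φ ⊥)

        length-++-low : ∀ (cs : List KMap) → length (low ++ cs) ≡ s′ ℕ.+ length cs
        length-++-low cs = ≡.trans (List.length-++ low) (≡.cong (ℕ._+ length cs) (List.length-tabulate _))

        isZero-++ : ∀ cs → IsZero (values (low ++ cs) φ) → IsZero (values low φ) × IsZero (values cs φ)
        isZero-++ cs z = let z′ = All.map⁻ z in All.map⁺ (All.++⁻ˡ low z′) , All.map⁺ (All.++⁻ʳ low z′)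

        zeros≤s : IsNonzero φ → zeros generators φ ℕ.≤ s
        zeros≤s φ≉0 with Fin.all? (λ i → φ (leading i) ≟ 0#)
        -- Both extra entries are nonzero, and `s + 1` coefficients allow at most `s` roots.
        ... | no leading≉0 = ℕ.≤-trans (ℕ.≤-reflexive
                (≡.trans (count-no orth? (leading≉0 ∘ extra₁⇒leading))
                  (count-no (orth? ∘ suc) (leading≉0 ∘ extra₂⇒leading))))
                (ℕ.≤-pred (ℕ.≤-trans (rootCount< coefficients (λ _ → K.refl) nonzero)
                  (ℕ.≤-reflexive (≡.trans (length-++-low (β ∷ α ∷ [])) (ℕ.+-comm s′ 2)))))
          where
          orth? = λ i → orthogonal? (generators i) φ
          nonzero : ¬ IsZero (values coefficients φ)
          nonzero z with isZero-++ (β ∷ α ∷ []) z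
          ... | _ , _ ∷ α≈0 ∷ [] = leading≉0 (pad⇒leading (combination-injective α≈0))
        ... | yes leading≈0 with Fin.all? (λ l → φ (block zero l) ≟ 0#)
        -- At most one extra entry vanishes, and the `s` coefficients left without `α` allow at most
        -- `s - 1` roots.
        ...   | no β≉0 = ℕ.≤-trans extras (s≤s (ℕ.≤-pred (ℕ.≤-trans (rootCount< (low ++ β ∷ []) dropα nonzero)
                (ℕ.≤-reflexive (≡.trans (length-++-low (β ∷ [])) (ℕ.+-comm s′ 1))))))
          where
          orth? = λ i → orthogonal? (generators i) φ
          extras : count orth? ℕ.≤ suc rootCount
          extras with orth? zero
          ... | yes ⊥₁ = ℕ.≤-reflexive (≡.trans (count-yes orth? ⊥₁)
                          (≡.cong suc (count-no (orth? ∘ suc) (β≉0 ∘ extras⇒β ⊥₁))))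
          ... | no ⊥̸₁  = ℕ.≤-trans (ℕ.≤-reflexive (count-no orth? ⊥̸₁)) (count-≤ (orth? ∘ suc))
          dropα : ∀ x → eval (values coefficients φ) x K.≈ eval (values (low ++ β ∷ []) φ) x
          dropα x = eval-++ low (K.+-congˡ (K.*-congˡ (K.trans
            (K.+-cong (combination-0 (leading⇒pad leading≈0)) (K.zeroʳ x)) (K.+-identityˡ K.0#))))
          nonzero : ¬ IsZero (values (low ++ β ∷ []) φ)
          nonzero z with isZero-++ (β ∷ []) z
          ... | _ , β≈0 ∷ [] = β≉0 (combination-injective β≈0)
        -- Both extra entries may vanish, but only the `s - 1` coefficients in `low` remain, giving
        -- fewer than `s - 1` roots.
        ...   | yes β≈0 = ℕ.≤-trans (count-≤ orth?) (s≤s (ℕ.≤-trans (count-≤ (orth? ∘ suc))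
                (ℕ.≤-trans (rootCount< low dropβα (λ z → φ≉0 (low-β-leading⇒0 z β≈0 leading≈0)))
                  (ℕ.≤-reflexive (List.length-tabulate _)))))
          where
          orth? = λ i → orthogonal? (generators i) φ
          dropβα : ∀ x → eval (values coefficients φ) x K.≈ eval (values low φ) x
          dropβα x = K.trans (eval-++ low {es = []} (eval-isZero
              (combination-0 β≈0 ∷ combination-0 (leading⇒pad leading≈0) ∷ []) x))
            (K.reflexive (≡.cong (λ cs → eval (values cs φ) x) (List.++-identityʳ low)))

    generators-isCode : IsCode s generators
    generators-isCode φ φ≉0 = zeros≤s φ φ≉0

-- Projective systems

fieldRing : HeytingField c ℓ₁ ℓ₂ → CommutativeRing c ℓ₁
fieldRing F = HeytingCommutativeRing.commutativeRing (HeytingField.heytingCommutativeRing F)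

isFiniteField : (F : HeytingField c ℓ₁ ℓ₂) → ∀ {q} → 1 ℕ.< q → HasOrder F q → IsFiniteField (fieldRing F) q
isFiniteField F {q} 1<q order = record
  { enumeration = order
  ; 1≉0         = λ 1≈0 → distinct 1<q (all-equal 1≈0)
  ; zeroOrUnit  = zeroOrUnit
  }
  where
  open HeytingField F using (tight; #⇒invertible)
  open CommutativeRing (fieldRing F) hiding (zero)
  open Algebra.Properties.Group +-group using (ε⁻¹≈ε)
  open Inverse order
  distinct : ∀ {q} → 1 ℕ.< q → ¬ (∀ (i j : Fin q) → i ≡ j)
  distinct (s≤s (s≤s _)) eq with () ← eq zero (suc zero)
  all-equal : 1# ≈ 0# → ∀ i j → i ≡ j
  all-equal 1≈0 i j = ≡.trans (≡.sym (strictlyInverseˡ i))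
    (≡.trans (to-cong (trans (≈0 (from i)) (sym (≈0 (from j))))) (strictlyInverseˡ j))
    where
    ≈0 : ∀ x → x ≈ 0#
    ≈0 x = trans (sym (*-identityˡ x)) (trans (*-congʳ 1≈0) (zeroˡ x))
  -- Inverses are found by exhaustive search; if there is none, `x` cannot be apart from zero, and
  -- tightness gives `x ≈ 0#`.
  zeroOrUnit : ∀ x → x ≈ 0# ⊎ ∃[ y ] x * y ≈ 1#
  zeroOrUnit x with finite-any? order (λ y≈z eq → trans (*-congˡ (sym y≈z)) eq) (λ y → finite-≟ order (x * y) 1#)
  ... | yes unit = inj₂ unit
  -- `#⇒invertible` inverts the difference of `x` and `0#`, which is rewritten to `x`.
  ... | no ¬unit = inj₁ (proj₁ (tight x 0#) λ x#0 → let y , _ , eq = #⇒invertible x#0 in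
    ¬unit (y , trans (*-congʳ (sym (trans (+-congˡ ε⁻¹≈ε) (+-identityʳ x)))) eq))

module Projective (F : HeytingField c ℓ₁ ℓ₂) {q} (isField : IsFiniteField (fieldRing F) q) where
  private
    R : CommutativeRing c ℓ₁
    R = fieldRing F
  open CommutativeRing R hiding (zero)
  open FiniteField isField
  open DotProduct R
  open Code R isField using (Orthogonal; orthogonal?; IsNonzero; zeros; IsCode)
  open VecEquality setoid
  open Algebra.Properties.Semiring.Sum semiring
  open Algebra.Properties.Group +-group using (∙-cancelʳ)
  open Algebra.Properties.Ring ring using (-‿distribˡ-*)

  ∙-congʳ : ∀ {r} (φ : Vector Carrier r) {v w} → v ≋ w → φ ∙ v ≈ φ ∙ w
  ∙-congʳ φ v≋w = ∙-cong {v = φ} (λ _ → refl) v≋w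

  kernel : ∀ {r} → Vector Carrier r → Subspace F r
  kernel φ = record
    -- `Lift` raises the equation to the level that `Subspace` prescribes for its predicates.
    { Member   = λ v → Lift c (φ ∙ v ≈ 0#)
    ; resp     = λ v≋w (lift eq) → lift (trans (∙-congʳ φ (λ i → sym (v≋w i))) eq)
    ; 0-mem    = lift (trans (∙-comm φ _) (∙-zero φ (λ _ → refl)))
    ; +-closed = λ {v} {w} (lift p) (lift q) → lift (trans (∙-+ φ v w) (trans (+-cong p q) (+-identityˡ 0#)))
    ; *-closed = λ a {v} (lift p) → lift (trans (∙-* a φ v) (trans (*-congˡ p) (zeroʳ a)))
    }

  module _ {r} (φ : Vector Carrier (suc r)) (j : Fin (suc r)) {w : Carrier} (φⱼw≈1 : φ j * w ≈ 1#) where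
    private
      open SetoidReasoning setoid

      -- For each index `i` other than `j`, the unit vector at `i` corrected at `j` by
      -- `- φ i / φ j`, which puts it into the kernel.
      b : Vector (Vector Carrier (suc r)) r
      b i t = unit {R = R} (punchIn j i) t + - (φ (punchIn j i) * w) * unit {R = R} j t

      unit-punchIn : ∀ i i′ → unit {R = R} (punchIn j i) (punchIn j i′) ≈ unit {R = R} i i′
      unit-punchIn i i′ with i Fin.≟ i′
      ... | yes ≡.refl = unit-same {R = R} (punchIn j i)
      ... | no  i≢i′   = unit-other {R = R} (i≢i′ ∘ Fin.punchIn-injective j i i′)

      unit-sym : ∀ (i t : Fin (suc r)) → unit {R = R} i t ≈ unit {R = R} t i
      unit-sym i t with i Fin.≟ t
      ... | yes ≡.refl = sym (unit-same {R = R} i)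
      ... | no i≢t     = sym (unit-other {R = R} (i≢t ∘ ≡.sym))

      ∙-unit : ∀ i → φ ∙ unit {R = R} i ≈ φ i
      ∙-unit i = trans (∙-congʳ φ (unit-sym i)) (sum-unit {R = R} φ i)

      b-member : ∀ i → φ ∙ b i ≈ 0#
      b-member i = begin
        φ ∙ b i
          ≈⟨ ∙-+ φ (unit {R = R} (punchIn j i)) (λ t → - x * unit {R = R} j t) ⟩
        φ ∙ unit {R = R} (punchIn j i) + φ ∙ (λ t → - x * unit {R = R} j t)
          ≈⟨ +-cong (∙-unit (punchIn j i)) (trans (∙-* (- x) φ (unit {R = R} j)) (*-congˡ (∙-unit j))) ⟩
        φ (punchIn j i) + - x * φ j
          ≈⟨ +-congˡ (trans (sym (-‿distribˡ-* x (φ j))) (-‿cong (trans (*-assoc _ w _)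
               (trans (*-congˡ (trans (*-comm w (φ j)) φⱼw≈1)) (*-identityʳ _))))) ⟩
        φ (punchIn j i) + - φ (punchIn j i)
          ≈⟨ -‿inverseʳ _ ⟩
        0# ∎
        where x = φ (punchIn j i) * w

      lc-b : ∀ a i → linearCombination F a b (punchIn j i) ≈ a i
      lc-b a i = trans (sum-cong-≋ (λ i′ → *-congˡ (begin
        unit {R = R} (punchIn j i′) (punchIn j i) + - (φ (punchIn j i′) * w) * unit {R = R} j (punchIn j i)
          ≈⟨ +-cong (unit-punchIn i′ i) (trans (*-congˡ (unit-other {R = R} (Fin.punchInᵢ≢i j i ∘ ≡.sym))) (zeroʳ _)) ⟩
        unit {R = R} i′ i + 0#
          ≈⟨ +-identityʳ _ ⟩
        unit {R = R} i′ i ∎))) (sum-unit {R = R} a i)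

      spanning : ∀ v → φ ∙ v ≈ 0# → linearCombination F (λ i → v (punchIn j i)) b ≋ v
      spanning v φ∙v≈0 t = cases (j Fin.≟ t)
        where
        a = λ i → v (punchIn j i)
        u = linearCombination F a b
        rest = sum (Vector.removeAt (λ t → φ t * v t) j)
        -- `u` and `v` agree off `j` and are both orthogonal to `φ`; cancelling the unit `φ j` gives
        -- agreement at `j`.
        at-j : u j ≈ v j
        at-j = *-cancelˡ-unit φⱼw≈1 (∙-cancelʳ rest _ _ (begin
          φ j * u j + rest
            ≈⟨ +-congˡ (sum-cong-≋ (λ i → *-congˡ (lc-b a i))) ⟨
          φ j * u j + sum (Vector.removeAt (λ t → φ t * u t) j)
            ≈⟨ sum-remove {i = j} (λ t → φ t * u t) ⟨
          φ ∙ u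
            ≈⟨ ∙-congʳ φ (lc-pointwise a b) ⟨
          φ ∙ lc a b
            ≈⟨ ∙-lc φ a b b-member ⟩
          0#
            ≈⟨ φ∙v≈0 ⟨
          φ ∙ v
            ≈⟨ sum-remove {i = j} (λ t → φ t * v t) ⟩
          φ j * v j + rest ∎))
        cases : ∀ {t} → Dec (j ≡ t) → u t ≈ v t
        cases (yes ≡.refl) = at-j
        cases (no j≢t)     = ≡.subst (λ t → u t ≈ v t) (Fin.punchIn-punchOut j≢t) (lc-b a (punchOut j≢t))

    kernel-dimension : HasDimension F (kernel φ) r
    kernel-dimension = b , record
      { members     = λ i → lift (b-member i)
      ; independent = λ a eq i → trans (sym (lc-b a i)) (eq (punchIn j i))
      ; spanning    = λ {v} (lift eq) → (λ i → v (punchIn j i)) , spanning v eq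
      }

  kernel-isHyperplane : ∀ {r} (φ : Vector Carrier r) → IsNonzero φ → IsHyperplane F (kernel φ)
  kernel-isHyperplane {zero}  φ φ≉0 = contradiction (λ ()) φ≉0
  kernel-isHyperplane {suc r} φ φ≉0 with Fin.any? (λ j → ¬? (φ j ≟ 0#))
  ... | no all≈0 = contradiction (λ j → decidable-stable (φ j ≟ 0#) (λ ≉ → all≈0 (j , ≉))) φ≉0
  ... | yes (j , φⱼ≉0) with zeroOrUnit (φ j)
  ...   | inj₁ φⱼ≈0           = contradiction φⱼ≈0 φⱼ≉0
  ...   | inj₂ (w , φⱼw≈1) = r , kernel-dimension φ j φⱼw≈1 , ≡.refl

  member-lc : ∀ {r k} (U : Subspace F r) (a : Vector Carrier k) v → (∀ i → Member U (v i)) → Member U (lc a v)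
  member-lc U = lc-closed (Member U) (Subspace.0-mem U) (Subspace.+-closed U) (λ x → Subspace.*-closed U x)

  basis-span : ∀ {r k} {U : Subspace F r} {b : Vector (Vector Carrier r) k} → IsBasis F U b →
               ∀ {v} → Member U v → Span b v
  basis-span {b = b} isBasis v∈U with IsBasis.spanning isBasis v∈U
  ... | a , eq = a , λ j → trans (lc-pointwise a b j) (eq j)

  span-member-of : ∀ {r k} (U : Subspace F r) {b : Vector (Vector Carrier r) k} →
                   (∀ i → Member U (b i)) → ∀ {v} → Span b v → Member U v
  span-member-of U {b} b∈U (a , eq) = Subspace.resp U eq (member-lc U a b b∈U)

  span : ∀ {r k} → Vector (Vector Carrier r) k → Subspace F r
  span {r} g = record
    { Member   = Span g
    ; resp     = span-resp
    ; 0-mem    = span-0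
    ; +-closed = span-+
    ; *-closed = span-*
    }

  ≋-dec : ∀ r → Decidable₂ (_≋_ {n = r})
  ≋-dec r = finite-≟ (vectorEnum enumeration r)

  span-dimension : ∀ {r k} (g : Vector (Vector Carrier r) k) → ∃[ d ] (HasDimension F (span g) d × d ℕ.≤ k)
  span-dimension {r} g with extractBasis isField (≋-dec r) g
  ... | d , d≤k , b , ind , g⊆b , b⊆g = d , (b , record
    { members     = b⊆g
    ; independent = λ a eq → ind a (λ j → trans (lc-pointwise a b j) (eq j))
    ; spanning    = λ v∈g → let a , eq = span-trans {w = g} g⊆b v∈g in
                      a , λ j → trans (sym (lc-pointwise a b j)) (eq j)
    }) , d≤k

  orthogonal⇔⊆kernel : ∀ {r k} (g : Vector (Vector Carrier r) k) φ →
                        (Orthogonal g φ → Span g ⊆′ Member (kernel φ)) ×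
                        (Span g ⊆′ Member (kernel φ) → Orthogonal g φ)
  orthogonal⇔⊆kernel g φ =
    (λ ⊥ → span-member-of (kernel φ) (λ l → lift (⊥ l))) ,
    (λ g⊆ker l → lower (g⊆ker {g l} (span-member g l)))

  -- Zero vectors fill the list up to exactly `h` generators without changing the span, so all
  -- members of a family have the same shape.
  padded : ∀ {r k h} → k ℕ.≤ h → Vector (Vector Carrier r) k → Vector (Vector Carrier r) h
  padded z≤n       b l       = λ _ → 0#
  padded (s≤s k≤h) b zero    = b zero
  padded (s≤s k≤h) b (suc l) = padded k≤h (b ∘ suc) l

  padded-⊇ : ∀ {r k h} (k≤h : k ℕ.≤ h) (b : Vector (Vector Carrier r) k) {P : Pred (Vector Carrier r) ℓ} →
             (∀ l → P (padded k≤h b l)) → ∀ i → P (b i)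
  padded-⊇ (s≤s k≤h) b     Pb zero    = Pb zero
  padded-⊇ (s≤s k≤h) b {P} Pb (suc i) = padded-⊇ k≤h (b ∘ suc) {P} (Pb ∘ suc) i

  Family : ℕ → ℕ → ℕ → Set c
  Family n r h = Vector (Vector (Vector Carrier r) h) n

  HasCode : ℕ → ℕ → ℕ → ℕ → Set _
  HasCode h r s n = Σ[ g ∈ Family n r h ] IsCode s g

  module _ {h r s : ℕ} where

    -- For nonzero `φ`, `kernel φ` is a hyperplane containing every space whose generators are
    -- orthogonal to `φ`, so `atMost` bounds the zeros.
    system⇒code : ∀ {n} → ProjectiveSystem F h n r s → HasCode h r s n
    system⇒code {n} S = g , code
      where
      open ProjectiveSystem S
      b : ∀ i → Vector (Vector Carrier r) (proj₁ (dimension i))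
      b i = proj₁ (proj₁ (proj₂ (dimension i)))
      g : Family n r h
      g i = padded (proj₂ (proj₂ (dimension i))) (b i)
      code : IsCode s g
      code φ φ≉0 with atMost (kernel φ) (kernel-isHyperplane φ φ≉0)
      ... | k , (T , ∈T⇔ , ∣T∣≡k) , k≤s = ℕ.≤-trans
        (Subset.p⊆q⇒∣p∣≤∣q∣ λ {i} i∈ →
          Equivalence.from (∈T⇔ i) (contained i (∈-satisfying⁻ (λ i → orthogonal? (g i) φ) i∈)))
        (ℕ.≤-trans (ℕ.≤-reflexive ∣T∣≡k) k≤s)
        where
        contained : ∀ i → Orthogonal (g i) φ → Member (spaces i) ⊆′ Member (kernel φ)
        contained i ⊥ v∈ = span-member-of (kernel φ)
          (λ l → lift (padded-⊇ (proj₂ (proj₂ (dimension i))) (b i) {P = λ w → φ ∙ w ≈ 0#} ⊥ l))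
          (basis-span (proj₂ (proj₁ (proj₂ (dimension i)))) v∈)

    code⇒system : ∀ {n} (g : Family n r h) → IsCode s g → (∃[ φ ] (IsNonzero φ × zeros g φ ≡ s)) →
                  ProjectiveSystem F h n r s
    code⇒system g code (φ , φ≉0 , zeros≡s) = record
      { spaces    = span ∘ g
      ; dimension = λ i → span-dimension (g i)
      ; atMost    = atMost
      ; exactly   = kernel φ , kernel-isHyperplane φ φ≉0 ,
          satisfying (λ i → orthogonal? (g i) φ) ,
          (λ i → mk⇔ {B = Span (g i) ⊆′ Member (kernel φ)}
                     (λ i∈ → proj₁ (orthogonal⇔⊆kernel (g i) φ) (∈-satisfying⁻ (λ i → orthogonal? (g i) φ) i∈))
                     (λ ⊆ker → ∈-satisfying⁺ (λ i → orthogonal? (g i) φ) (proj₂ (orthogonal⇔⊆kernel (g i) φ) ⊆ker))) ,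
          zeros≡s
      }
      where
      -- `H` is only a predicate, but its basis makes containment decidable and, having fewer than
      -- `r` vectors, is annihilated by some nonzero `ψ`. What lies in `H` is then a zero of `ψ`.
      atMost : ∀ H → IsHyperplane F H → ∃[ k ] (ContainsExactly F H (span ∘ g) k × k ℕ.≤ s)
      atMost H (k , (b , isBasis) , ≡.refl) = count inside? ,
        (satisfying inside? ,
          (λ i → mk⇔ {B = Span (g i) ⊆′ Member H}
            (λ i∈ → span-member-of H (λ l → span-member-of H (IsBasis.members isBasis) (∈-satisfying⁻ inside? i∈ l)))
            (λ g⊆H → ∈-satisfying⁺ inside? (⊆⇒inside i g⊆H))) ,
          ≡.refl) ,
        ℕ.≤-trans (count-mono inside? (λ i → orthogonal? (g i) ψ) inside⇒⊥) (code ψ ψ≉0)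
        where
        inside? : Decidable (λ i → ∀ l → Span b (g i l))
        inside? i = Fin.all? (λ l → span? isField (≋-dec r) b (g i l))
        ⊆⇒inside : ∀ i → Span (g i) ⊆′ Member H → ∀ l → Span b (g i l)
        ⊆⇒inside i g⊆H l = basis-span isBasis (g⊆H {g i l} (span-member (g i) l))
        annihilating = annihilator isField (ℕ.n<1+n k) b
        ψ = proj₁ annihilating
        ψ≉0 = proj₂ (proj₂ annihilating)
        inside⇒⊥ : ∀ i → (∀ l → Span b (g i l)) → Orthogonal (g i) ψ
        inside⇒⊥ i g⊆b l = lower (span-member-of (kernel ψ) (λ j → lift (proj₁ (proj₂ annihilating) j)) (g⊆b l))

    nonzero? : Decidable (IsNonzero {r})
    nonzero? φ = ¬? (Fin.all? (λ j → φ j ≟ 0#))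

    nonzero-resp : ∀ {φ ψ : Vector Carrier r} → φ ≋ ψ → IsNonzero φ → IsNonzero ψ
    nonzero-resp φ≋ψ φ≉0 ψ≋0 = φ≉0 (λ j → trans (φ≋ψ j) (ψ≋0 j))

    zeros-cong : ∀ {n} {g g′ : Family n r h} {φ φ′} → (∀ i l → g i l ≋ g′ i l) → φ ≋ φ′ → zeros g φ ≡ zeros g′ φ′
    zeros-cong {g = g} {g′} {φ} {φ′} g≋ φ≋ = ℕ.≤-antisym
      (count-mono (λ i → orthogonal? (g i) φ) (λ i → orthogonal? (g′ i) φ′)
        (λ i ⊥ l → trans (sym (∙-cong φ≋ (g≋ i l))) (⊥ l)))
      (count-mono (λ i → orthogonal? (g′ i) φ′) (λ i → orthogonal? (g i) φ)
        (λ i ⊥ l → trans (∙-cong φ≋ (g≋ i l)) (⊥ l)))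

    -- Subspaces as predicates cannot be enumerated, but generator families and functionals can, so
    -- both quantifiers are finite searches.
    hasCode? : Decidable (HasCode h r s)
    hasCode? n = finite-any? (vectorEnum (vectorEnum (vectorEnum enumeration r) h) n)
      (λ g≋ code φ φ≉0 → ≡.subst (ℕ._≤ s) (zeros-cong g≋ (λ _ → refl)) (code φ φ≉0))
      (λ g → finite-all? (vectorEnum enumeration r)
        (λ φ≋ψ bound ψ≉0 → ≡.subst (ℕ._≤ s) (zeros-cong {g = g} (λ _ _ _ → refl) φ≋ψ)
          (bound (nonzero-resp (λ j → sym (φ≋ψ j)) ψ≉0)))
        (λ φ → nonzero? φ →-dec (zeros g φ ℕ.≤? s)))

    -- Each member is annihilated by one of the q ^ r functionals, each of which annihilates at most s members.
    code-bound : h ℕ.< r → ∀ {n} → HasCode h r s n → n ℕ.≤ q ℕ.^ r ℕ.* s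
    code-bound h<r {n} (g , code) = cover-bound (q ℕ.^ r) s (λ j → satisfying (killed? (from j))) small covered
      where
      open Inverse (vectorEnum enumeration r)
      killed? : ∀ φ → Decidable (λ i → IsNonzero φ × Orthogonal (g i) φ)
      killed? φ i = nonzero? φ ×-dec orthogonal? (g i) φ
      small : ∀ j → count (killed? (from j)) ℕ.≤ s
      small j with nonzero? (from j)
      ... | yes φ≉0 = ℕ.≤-trans
        (count-mono (killed? (from j)) (λ i → orthogonal? (g i) (from j)) (λ _ → proj₂)) (code (from j) φ≉0)
      ... | no φ≋0  = ℕ.≤-trans
        (Subset.p⊆q⇒∣p∣≤∣q∣ {q = ⊥} (λ i∈ → contradiction (proj₁ (∈-satisfying⁻ (killed? (from j)) i∈)) φ≋0))
        (ℕ.≤-trans (ℕ.≤-reflexive (Subset.∣⊥∣≡0 n)) z≤n)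
      covered : ∀ i → ∃[ j ] i ∈ satisfying (killed? (from j))
      covered i with annihilator isField h<r (g i)
      ... | φ , ⊥ , φ≉0 = to φ , ∈-satisfying⁺ (killed? (from (to φ)))
        (nonzero-resp (λ t → sym (strictlyInverseʳ φ t)) φ≉0 ,
         λ l → trans (∙-cong (strictlyInverseʳ φ) (λ _ → refl)) (⊥ l))

    -- If no hyperplane contains exactly s members, then the zero space can be added.
    code-tight : ∀ {n} → (g : Family n r h) → IsCode s g → ¬ HasCode h r s (suc n) →
                 ∃[ φ ] (IsNonzero φ × zeros g φ ≡ s)
    code-tight {n} g code maximal with finite-any? (vectorEnum enumeration r)
      (λ φ≋ψ (φ≉0 , eq) → nonzero-resp φ≋ψ φ≉0 , ≡.trans (zeros-cong {g = g} (λ _ _ _ → refl) (λ j → sym (φ≋ψ j))) eq)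
      (λ φ → nonzero? φ ×-dec (zeros g φ ℕ.≟ s))
    ... | yes tight = tight
    ... | no ¬tight = contradiction (g′ , code′) maximal
      where
      g′ : Family (suc n) r h
      g′ = (λ _ _ → 0#) Vector.∷ g
      code′ : IsCode s g′
      code′ φ φ≉0 = ℕ.≤-trans (count-≤ (λ i → orthogonal? (g′ i) φ))
        (ℕ.≤∧≢⇒< (code φ φ≉0) (λ eq → ¬tight (φ , φ≉0 , eq)))

    -- Systems give codes, so the longest code bounds them. Conversely the longest code is tight, as
    -- it cannot be extended, and therefore comes from a system.
    maxSize : h ℕ.< r → ∀ {n} → HasCode h r s n → ∃[ m ] (IsMaxSize F r h s m × n ℕ.≤ m)
    maxSize h<r {n} code with bounded-maximum hasCode? n (q ℕ.^ r ℕ.* s) code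
                                (λ m code′ → ℕ.≤-trans (code-bound h<r code′) (ℕ.m≤m+n _ n))
    ... | m , (g , codeₘ) , n≤m , largest = m , record
      { attained   = code⇒system g codeₘ (code-tight g codeₘ (λ code′ → ℕ.<-irrefl ≡.refl (largest (suc m) code′)))
      ; upperBound = λ m′ S → largest m′ (system⇒code S)
      } , n≤m

-- Parameters of the construction and the lower bound

open import Data.Nat.Base using (_+_; _*_; _^_; _≤_; ⌊_/2⌋; ⌈_/2⌉)

theorem4 : ∀ {c ℓ₁ ℓ₂} (q : ℕ) → IsPrimePower q →
    (F : HeytingField c ℓ₁ ℓ₂) → HasOrder F q →
    (h s : ℕ) → 2 ≤ h → 2 ≤ s →
    ∃[ n ] (IsMaxSize F (h * s + ⌊ h /2⌋) h s n × q ^ h + 2 ≤ n)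
theorem4 q (p , k , pr , 1≤k , q≡p^k) F order h@(suc h′) s@(suc s′) 2≤h 2≤s =
  let size , isMax , bound = result in
  size , isMax , ℕ.≤-trans (ℕ.≤-reflexive (ℕ.+-comm (q ^ h) 2)) bound
  where
  1<p : 1 ℕ.< p
  1<p = ℕ.nonTrivial⇒n>1 p {{prime⇒nonTrivial pr}}
  1<q : 1 ℕ.< q
  1<q = ≡.subst (1 ℕ.<_) (≡.sym q≡p^k) (ℕ.^-monoʳ-< p 1<p 1≤k)
  isField = isFiniteField F 1<q order

  -- The parity of `h`, as the difference of its two rounded halves.
  t : ℕ
  t = ⌈ h /2⌉ ℕ.∸ ⌊ h /2⌋

  h≡ : h ≡ ⌊ h /2⌋ + (⌊ h /2⌋ + t)
  h≡ = ≡.sym (≡.trans (≡.cong (⌊ h /2⌋ +_) (ℕ.m+[n∸m]≡n (ℕ.⌊n/2⌋≤⌈n/2⌉ h))) (ℕ.⌊n/2⌋+⌈n/2⌉≡n h))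

  K : Extension (fieldRing F) q h
  K = extension isField {p} {k} pr q≡p^k h′ (q ^ h ℕ.∸ 2)
        -- Subtracting two is exact because `q ^ 0 < q ^ h`.
        (≡.sym (ℕ.m+[n∸m]≡n (ℕ.^-monoʳ-< q 1<q {0} {h} (s≤s z≤n))))

  -- Here `h` is generalized so that its decomposition can be matched with `≡.refl`, which the
  -- splitting into halves requires.
  code : ∀ {h} k t → h ≡ k + (k + t) → Extension (fieldRing F) q h →
         Projective.HasCode F isField h (h * s + k) s (2 + q ^ h)
  code k t ≡.refl E = Code.generators (fieldRing F) isField k t s′ E ,
                      Code.generators-isCode (fieldRing F) isField k t s′ E

  -- From `2 ≤ s`; it ensures that every member is annihilated by some nonzero functional, hence
  -- that code lengths are bounded.
  h<r : h ℕ.< h * s + ⌊ h /2⌋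
  h<r = ℕ.<-≤-trans (ℕ.m<m*n h s 2≤s) (ℕ.m≤m+n (h * s) ⌊ h /2⌋)

  result = Projective.maxSize F isField h<r (code ⌊ h /2⌋ t h≡ K)
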